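{- Let $a,m$ be positive integers and let $\psi:\mathbb{Z}\to\mathbb{Z}$ be a function such that for every $k\in\mathbb{Z}$ and every $j=1,\ldots,a$ we have $\psi(k)\equiv\psi(-k)\pmod{3^a}$ and $\psi(k+3^j)\equiv\psi(k)\pmod{3^j}$. Then $$\sum_{k=1}^{3^am-1}q^{\psi(k)}\left(\frac{k}{3}\right)\begin{bmatrix}2\cdot 3^am\\k\end{bmatrix}_q\equiv 0\pmod{[3^a]_q^2}.$$ In particular, $$\sum_{k=1}^{3^am-1}\left(\frac{k}{3}\right)\begin{bmatrix}2\cdot 3^am\\k\end{bmatrix}_q\equiv 0\pmod{[3^a]_q^2}.$$
   Context: $\left(\frac{k}{3}\right)$ is the Legendre symbol modulo 3: it equals $0$ if $3\mid k$, $1$ if $k\equiv1\pmod 3$, and $-1$ if $k\equiv 2\pmod 3$. For $n\in\mathbb{N}$, $[n]_q=\frac{1-q^n}{1-q}=\sum_{0\le k<n}q^k$, and for $n,k\in\mathbb{N}$ the $q$-binomial coefficient is $\begin{bmatrix}n\\k\end{bmatrix}_q=\frac{[n]_q\cdots[n-k+1]_q}{[1]_q\cdots[k]_q}$ for $0<k\le n$, $1$ for $k=0$, $0$ for $k>n$. Congruences are understood in the Laurent polynomial ring $\mathbb{Z}[q,q^{ -1}]$ (since $\psi$ may take negative values). -}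

module Defs where

open import Data.Nat as ℕ using (ℕ; zero; suc; _∸_; _^_; _%_)
open import Data.Integer as ℤ using (ℤ; +_; -_; _-_; _≟_)
open import Data.Product using (_×_; _,_; Σ)
open import Data.List using (List; []; _∷_; _++_; map; concatMap; upTo; foldr)
open import Relation.Nullary using (yes; no)
open import Relation.Binary.PropositionalEquality using (_≡_)

-- Laurent polynomials in ℤ[q,q⁻¹], represented as finite formal sums of
-- monomials: a list of (exponent , coefficient) pairs meaning Σ c·q^e.
Laurent : Set
Laurent = List (ℤ × ℤ)

coeff : Laurent → ℤ → ℤ
coeff []             n = + 0
coeff ((e , c) ∷ f) n with e ≟ n
... | yes _ = c ℤ.+ coeff f n
... | no  _ = coeff f n

infix 4 _≈L_
_≈L_ : Laurent → Laurent → Set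
f ≈L g = ∀ n → coeff f n ≡ coeff g n

0L : Laurent
0L = []

1L : Laurent
1L = (+ 0 , + 1) ∷ []

qpow : ℤ → Laurent
qpow e = (e , + 1) ∷ []

infixl 6 _+L_
_+L_ : Laurent → Laurent → Laurent
f +L g = f ++ g

infixl 7 _*L_
_*L_ : Laurent → Laurent → Laurent
f *L g = concatMap (λ { (e , c) → map (λ { (e' , c') → (e ℤ.+ e' , c ℤ.* c') }) g }) f

infixl 7 _·L_
_·L_ : ℤ → Laurent → Laurent
z ·L f = map (λ { (e , c) → (e , z ℤ.* c) }) f

infix 4 _∣L_
_∣L_ : Laurent → Laurent → Set
g ∣L f = Σ Laurent (λ h → f ≈L (g *L h))

qint : ℕ → Laurent
qint n = map (λ k → (+ k , + 1)) (upTo n)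

-- q-binomial coefficient, via the q-Pascal recurrence
-- [n+1, k+1] = [n, k] + q^(k+1) [n, k+1],  [n,0] = 1,  [0,k+1] = 0.
qbinom : ℕ → ℕ → Laurent
qbinom n       zero    = 1L
qbinom zero    (suc k) = 0L
qbinom (suc n) (suc k) = qbinom n k +L (qpow (+ suc k) *L qbinom n (suc k))

legendre3 : ℕ → ℤ
legendre3 k with k % 3
... | 0 = + 0
... | 1 = + 1
... | _ = - (+ 1)

sumFrom1 : ℕ → (ℕ → Laurent) → Laurent
sumFrom1 N f = foldr _+L_ 0L (map (λ k → f (suc k)) (upTo (N ∸ 1)))

{-# OPTIONS --safe #-}
module Submission where

-- Write [n] for [n]_q, P = 3ᵃ, N = P m, and Φ = [3ʲ⁺¹]/[3ʲ] with d = 3ʲ⁺¹, j < a.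
--
-- If 3 ∤ k, then [k] and [P] are comaximal (Bézout), so absorption [k] binom(2N, k) =
-- [2N] binom(2N − 1, k − 1) gives binom(2N, k) = [P] Fₖ with [k] Fₖ = ([2N]/[P]) binom(2N − 1, k − 1).
-- It remains to see that [P] divides S = ∑ (k/3) q^ψ(k) Fₖ.  Modulo Φ, the q-Lucas congruence
-- and the invertibility of [r] give F_{ud+r} ≡ C_u G_r for 0 < r < d, 3 ∤ r, where
-- G_r = binom(d, r)/[d].  Since G_r = G_{d−r} and ((d−r)/3) = −(r/3), the terms r and d − r
-- of each block of length d cancel, so Φ divides S.  Finally Φ ≡ 3 modulo [3ʲ], so if [3ʲ] and Φ
-- divide S then [3ʲ⁺¹] = [3ʲ] Φ divides 3S, hence S because ℤ[q,q⁻¹]/[n] has no torsion.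

open import Defs
open import Algebra.Bundles using (CommutativeRing)
open import Algebra.Properties.CommutativeSemigroup using (x∙yz≈y∙xz)
open import Algebra.Structures using (IsCommutativeRing)
import Data.Integer.Divisibility as ℤᵤ
open import Data.Integer.Divisibility.Signed as ℤ∣ using (divides)
import Data.Integer.Properties as ℤₚ
import Data.Integer.Tactic.RingSolver as ℤ-solver
open import Data.List using ([]; _∷_; _++_; map; upTo; applyUpTo; filter; length; foldr)
open import Data.List.Properties using (map-upTo; upTo-∷ʳ; map-++; length-filter)
open import Data.Nat as ℕ using (ℕ; zero; suc; z≤n; s≤s)
open import Data.Nat.Coprimality using (Coprime; coprime-divisor; coprime⇒gcd≡1)
import Data.Nat.Divisibility as ℕ∣
import Data.Nat.DivMod as ℕ%
open import Data.Nat.GCD using (gcd; gcd-GCD; gcd[m,n]∣m; gcd[m,n]∣n; module Bézout)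
open import Data.Nat.Primality using (Prime; prime?; prime⇒irreducible; prime⇒nonZero)
import Data.Nat.Properties as ℕₚ
import Data.Nat.Tactic.RingSolver as ℕ-solver
open import Data.Product using (∃; _×_; _,_; proj₁; proj₂)
open import Data.Sum using (_⊎_; inj₁; inj₂)
open import Level using (0ℓ)
open import Relation.Binary.Bundles using (Setoid)
open import Relation.Binary.PropositionalEquality as ≡ using (_≡_; _≢_)
open import Relation.Nullary using (¬_; Dec; yes; no; ¬?; contradiction)
open import Relation.Nullary.Decidable using (from-yes)

-- Two obstacles shape the argument. The modulus `[P]²` is a square, and the cofactors `Fₖ` exist to
-- take one factor `[P]` out of every term beforehand. The remaining `[P]` is the product of the `Φ`
-- over all levels `j < a`; these are coprime over the rationals but not over the integers, so
-- divisibility by each of them does not simply multiply up. The missing 3-torsion makes up for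
-- this. The symmetry `k ↦ 2N - k` of the binomial coefficients leaves the range `0 < k < N`, so the
-- cancellation has to come from inside short blocks. There q-Lucas replaces `F` by `G`, which is
-- symmetric under `r ↦ d - r`, times a factor that is constant on the block. Inverses modulo `Φ`
-- are never constructed. Cancelling `[k]` is a q-analogue of Bézout: an element dividing `[m] z`
-- and `[n] z` divides `[gcd m n] z`.

-- Powers of 3

prime∤⇒coprime : ∀ {p n} → Prime p → ¬ p ℕ∣.∣ n → Coprime n p
prime∤⇒coprime p-prime p∤n (d∣n , d∣p) with prime⇒irreducible p-prime d∣p
... | inj₁ d≡1    = d≡1
... | inj₂ ≡.refl = contradiction d∣n p∤n

coprime-^ : ∀ {n p} → Coprime n p → ∀ j → Coprime n (p ℕ.^ j)
coprime-^ n⊥p zero    (d∣n , d∣1) = ℕ∣.∣1⇒≡1 d∣1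
coprime-^ n⊥p (suc j) (d∣n , d∣p^) =
  coprime-^ n⊥p j (d∣n , coprime-divisor (λ (c∣d , c∣p) → n⊥p (ℕ∣.∣-trans c∣d d∣n , c∣p)) d∣p^)

-- If `p` does not divide `n`, coprimality removes a factor `p` from the power; otherwise `p`
-- cancels on both sides and the exponent drops. It serves to bound `gcd i d` for `0 < i < d`, where
-- the full power is impossible.
∣prime-power : ∀ {p} → Prime p → ∀ j {n} → n ℕ∣.∣ p ℕ.^ suc j → n ≡ p ℕ.^ suc j ⊎ n ℕ∣.∣ p ℕ.^ j
∣prime-power {p} p-prime j {n} n∣p^ with p ℕ∣.∣? n
... | no  p∤n = inj₂ (coprime-divisor (prime∤⇒coprime p-prime p∤n) n∣p^)
... | yes (ℕ∣.divides k ≡.refl) = step j (ℕ∣.*-cancelˡ-∣ p {{prime⇒nonZero p-prime}}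
                                    (≡.subst (ℕ∣._∣ p ℕ.^ suc j) (ℕₚ.*-comm k p) n∣p^))
  where
  step : ∀ j → k ℕ∣.∣ p ℕ.^ j → k ℕ.* p ≡ p ℕ.^ suc j ⊎ k ℕ.* p ℕ∣.∣ p ℕ.^ j
  step zero    k∣1 = inj₁ (≡.trans (≡.cong (ℕ._* p) (ℕ∣.∣1⇒≡1 k∣1)) (ℕₚ.*-comm 1 p))
  step (suc j) k∣p^ with ∣prime-power p-prime j k∣p^
  ... | inj₁ k≡ = inj₁ (≡.trans (≡.cong (ℕ._* p) k≡) (ℕₚ.*-comm (p ℕ.^ suc j) p))
  ... | inj₂ k∣ = inj₂ (≡.subst (ℕ∣._∣ p ℕ.^ suc j) (ℕₚ.*-comm p k) (ℕ∣.*-monoʳ-∣ p k∣))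

3-prime : Prime 3
3-prime = from-yes (prime? 3)

∤3⇒coprime : ∀ {k} → ¬ 3 ℕ∣.∣ k → ∀ j → gcd k (3 ℕ.^ j) ≡ 1
∤3⇒coprime 3∤k j = coprime⇒gcd≡1 (coprime-^ (prime∤⇒coprime 3-prime 3∤k) j)

-- For `d = 3 ^ j` the nonzero residues `1, ..., d - 1` are then `h + h` in number, and `r ↦ d - r`
-- pairs them without a fixed point.
3^-odd : ∀ j → ∃ λ h → 3 ℕ.^ j ≡ suc (h ℕ.+ h)
3^-odd zero = 0 , ≡.refl
3^-odd (suc j) with 3^-odd j
... | h , eq = suc (3 ℕ.* h) , ≡.trans (≡.cong (3 ℕ.*_) eq) (lemma h)
  where
  lemma : ∀ h → 3 ℕ.* suc (h ℕ.+ h) ≡ suc (suc (3 ℕ.* h) ℕ.+ suc (3 ℕ.* h))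
  lemma = ℕ-solver.solve-∀

-- Divisibility and congruence in a commutative ring

module Congruence {c ℓ} (R : CommutativeRing c ℓ) where
  open CommutativeRing R hiding (zero)
  open import Algebra.Properties.Semiring.Divisibility semiring
  open import Algebra.Properties.Ring ring
  open import Algebra.Properties.CommutativeSemigroup +-commutativeSemigroup using (interchange)

  ∣-+ : ∀ {p x y} → p ∣ x → p ∣ y → p ∣ x + y
  ∣-+ {p} (u , up≈x) (v , vp≈y) = u + v , trans (distribʳ p u v) (+-cong up≈x vp≈y)

  ∣-neg : ∀ {p x} → p ∣ x → p ∣ - x
  ∣-neg {p} (u , up≈x) = - u , trans (sym (-‿distribˡ-* u p)) (-‿cong up≈x)

  ∣-*ʳ : ∀ {p x} y → p ∣ x → p ∣ x * y
  ∣-*ʳ {x = x} y p∣x = ∣ʳ-respʳ-≈ (*-comm y x) (x∣ʳy⇒x∣ʳzy y p∣x)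

  x+y-y≈x : ∀ x y → (x + y) - y ≈ x
  x+y-y≈x x y = trans (+-assoc x y (- y)) (trans (+-congˡ (-‿inverseʳ y)) (+-identityʳ x))

  x-y+y≈x : ∀ x y → (x - y) + y ≈ x
  x-y+y≈x x y = trans (+-assoc x (- y) y) (trans (+-congˡ (-‿inverseˡ y)) (+-identityʳ x))

  ∣-+-cancelʳ : ∀ {p x y} → p ∣ x + y → p ∣ y → p ∣ x
  ∣-+-cancelʳ {x = x} {y} p∣x+y p∣y = ∣ʳ-respʳ-≈ (x+y-y≈x x y) (∣-+ p∣x+y (∣-neg p∣y))

  module Modulo (p : Carrier) where

    infix 4 _∼_
    _∼_ : Carrier → Carrier → Set _
    x ∼ y = p ∣ x - y

    ∼-reflexive : ∀ {x y} → x ≈ y → x ∼ y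
    ∼-reflexive {x} {y} x≈y = ∣ʳ-respʳ-≈ (sym (x≈y⇒x∙y⁻¹≈ε x≈y)) (p ∣0)

    ∼-refl : ∀ {x} → x ∼ x
    ∼-refl = ∼-reflexive refl

    ∼-sym : ∀ {x y} → x ∼ y → y ∼ x
    ∼-sym {x} {y} x∼y = ∣ʳ-respʳ-≈ (⁻¹-anti-homo-// x y) (∣-neg x∼y)

    ∼-trans : ∀ {x y z} → x ∼ y → y ∼ z → x ∼ z
    ∼-trans {x} {y} {z} x∼y y∼z = ∣ʳ-respʳ-≈ lemma (∣-+ x∼y y∼z)
      where
      lemma : (x - y) + (y - z) ≈ x - z
      lemma = trans (sym (+-assoc (x - y) y (- z))) (+-congʳ (x-y+y≈x x y))

    ∼-+ : ∀ {x y u v} → x ∼ y → u ∼ v → x + u ∼ y + v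
    ∼-+ {x} {y} {u} {v} x∼y u∼v = ∣ʳ-respʳ-≈
      (trans (interchange x (- y) u (- v)) (+-congˡ (-‿+-comm y v))) (∣-+ x∼y u∼v)

    ∼-*ˡ : ∀ z {x y} → x ∼ y → z * x ∼ z * y
    ∼-*ˡ z {x} {y} x∼y = ∣ʳ-respʳ-≈ (x[y-z]≈xy-xz z x y) (x∣ʳy⇒x∣ʳzy z x∼y)

    ∼-*ʳ : ∀ z {x y} → x ∼ y → x * z ∼ y * z
    ∼-*ʳ z {x} {y} x∼y = ∣ʳ-respʳ-≈ ([y-z]x≈yx-zx z x y) (∣-*ʳ z x∼y)

    ∼-* : ∀ {x y u v} → x ∼ y → u ∼ v → x * u ∼ y * v
    ∼-* {x} {y} {u} {v} x∼y u∼v = ∼-trans (∼-*ʳ u x∼y) (∼-*ˡ y u∼v)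

    ∣⇒∼0 : ∀ {x} → p ∣ x → x ∼ 0#
    ∣⇒∼0 {x} = ∣ʳ-respʳ-≈ (sym (trans (+-congˡ -0#≈0#) (+-identityʳ x)))

    ∼0⇒∣ : ∀ {x} → x ∼ 0# → p ∣ x
    ∼0⇒∣ {x} = ∣ʳ-respʳ-≈ (trans (+-congˡ -0#≈0#) (+-identityʳ x))

-- Finite sums modulo an element

module Sums {c ℓ} (R : CommutativeRing c ℓ) where
  open CommutativeRing R hiding (zero)
  open import Algebra.Properties.Semiring.Divisibility semiring
  open import Relation.Binary.Reasoning.Setoid setoid
  open Congruence R

  ∑ : ℕ → (ℕ → Carrier) → Carrier
  ∑ zero    f = 0#
  ∑ (suc n) f = f 0 + ∑ n (λ i → f (suc i))

  ∑-cong : ∀ n {f g} → (∀ i → f i ≈ g i) → ∑ n f ≈ ∑ n g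
  ∑-cong zero    f≈g = refl
  ∑-cong (suc n) f≈g = +-cong (f≈g 0) (∑-cong n (λ i → f≈g (suc i)))

  ∑-*ˡ : ∀ n x f → ∑ n (λ i → x * f i) ≈ x * ∑ n f
  ∑-*ˡ zero    x f = sym (zeroʳ x)
  ∑-*ˡ (suc n) x f = trans (+-congˡ (∑-*ˡ n x _)) (sym (distribˡ x _ _))

  ∑-snoc : ∀ n f → ∑ (suc n) f ≈ ∑ n f + f n
  ∑-snoc zero    f = trans (+-identityʳ _) (sym (+-identityˡ _))
  ∑-snoc (suc n) f = trans (+-congˡ (∑-snoc n (λ i → f (suc i)))) (sym (+-assoc _ _ _))

  ∑-+ : ∀ m n f → ∑ (m ℕ.+ n) f ≈ ∑ m f + ∑ n (λ i → f (m ℕ.+ i))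
  ∑-+ zero    n f = sym (+-identityˡ _)
  ∑-+ (suc m) n f = trans (+-congˡ (∑-+ m n (λ i → f (suc i)))) (sym (+-assoc _ _ _))

  module _ (p : Carrier) where
    open Modulo p

    ∣-∑-blocks : ∀ m d f → (∀ u → p ∣ ∑ d (λ r → f (r ℕ.+ u ℕ.* d))) → p ∣ ∑ (m ℕ.* d) f
    ∣-∑-blocks zero    d f p∣block = p ∣0
    ∣-∑-blocks (suc m) d f p∣block = ∣ʳ-respʳ-≈ (sym (∑-+ d (m ℕ.* d) f))
      (∣-+ (∣ʳ-respʳ-≈ (∑-cong d λ r → reflexive (≡.cong f (ℕₚ.+-identityʳ r))) (p∣block 0))
           (∣-∑-blocks m d (λ i → f (d ℕ.+ i)) λ u →
             ∣ʳ-respʳ-≈ (∑-cong d λ r → reflexive (≡.cong f (x∙yz≈y∙xz ℕₚ.+-commutativeSemigroup r d (u ℕ.* d))))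
               (p∣block (suc u))))

    ∑-∼ : ∀ n {f g} → (∀ i → i ℕ.< n → f i ∼ g i) → ∑ n f ∼ ∑ n g
    ∑-∼ zero    f∼g = ∼-refl
    ∑-∼ (suc n) f∼g = ∼-+ (f∼g 0 (s≤s z≤n)) (∑-∼ n (λ i i<n → f∼g (suc i) (s≤s i<n)))

    -- The first and the last term are peeled off together. The even length matters: a middle term
    -- `f i` would only be known to satisfy `p ∣ f i + f i`.
    ∣-∑-antisymmetric : ∀ h f → (∀ i j → suc (i ℕ.+ j) ≡ h ℕ.+ h → p ∣ f i + f j) →
                        p ∣ ∑ (h ℕ.+ h) f
    ∣-∑-antisymmetric zero    f anti = p ∣0
    ∣-∑-antisymmetric (suc h) f anti rewrite ℕₚ.+-suc h h =
      ∣ʳ-respʳ-≈ (sym (begin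
        f 0 + ∑ (suc (h ℕ.+ h)) f′               ≈⟨ +-congˡ (∑-snoc (h ℕ.+ h) f′) ⟩
        f 0 + (∑ (h ℕ.+ h) f′ + f′ (h ℕ.+ h))    ≈⟨ +-congˡ (+-comm _ _) ⟩
        f 0 + (f′ (h ℕ.+ h) + ∑ (h ℕ.+ h) f′)    ≈⟨ +-assoc _ _ _ ⟨
        (f 0 + f′ (h ℕ.+ h)) + ∑ (h ℕ.+ h) f′    ∎))
      (∣-+ (anti 0 (suc (h ℕ.+ h)) ≡.refl)
           (∣-∑-antisymmetric h f′ λ i j eq →
             anti (suc i) (suc j) (≡.cong suc (≡.trans (≡.cong suc (ℕₚ.+-suc i j)) (≡.cong suc eq)))))
      where
      f′ : ℕ → Carrier
      f′ i = f (suc i)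

-- q-integers and q-binomial coefficients

module QAnalogue {c ℓ} (R : CommutativeRing c ℓ) (q : CommutativeRing.Carrier R) where
  open CommutativeRing R hiding (zero)
  open import Algebra.Properties.Semiring.Divisibility semiring
  open import Algebra.Properties.Semiring.Exp semiring using (_^_)
  open import Algebra.Solver.Ring.NaturalCoefficients.Default commutativeSemiring
  open import Relation.Binary.Reasoning.Setoid setoid
  open Congruence R

  infix 9 [_]
  [_] : ℕ → Carrier
  [ zero ]  = 0#
  [ suc n ] = 1# + q * [ n ]

  binom : ℕ → ℕ → Carrier
  binom n       zero    = 1#
  binom zero    (suc k) = 0#
  binom (suc n) (suc k) = binom n k + q ^ suc k * binom n (suc k)

  []-+ : ∀ m n → [ m ℕ.+ n ] ≈ [ m ] + q ^ m * [ n ]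
  []-+ zero    n = sym (trans (+-identityˡ _) (*-identityˡ _))
  []-+ (suc m) n = trans (+-congˡ (*-congˡ ([]-+ m n)))
    (solve 4 (λ q m p n → con 1 :+ q :* (m :+ p :* n) := con 1 :+ q :* m :+ q :* p :* n)
       refl q [ m ] (q ^ m) [ n ])

  [m]∣[n*m] : ∀ m n → [ m ] ∣ [ n ℕ.* m ]
  [m]∣[n*m] m zero    = [ m ] ∣0
  [m]∣[n*m] m (suc n) = ∣ʳ-respʳ-≈ (sym ([]-+ m (n ℕ.* m)))
    (∣-+ ∣ʳ-refl (x∣ʳy⇒x∣ʳzy (q ^ m) ([m]∣[n*m] m n)))

  []-mono-∣ : ∀ {m n} → m ℕ∣.∣ n → [ m ] ∣ [ n ]
  []-mono-∣ {m} (ℕ∣.divides k ≡.refl) = [m]∣[n*m] m k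

  ^-[] : ∀ n → q ^ n ≈ 1# + (q - 1#) * [ n ]
  ^-[] zero    = sym (trans (+-congˡ (zeroʳ _)) (+-identityʳ 1#))
  ^-[] (suc n) = begin
    -- With `p` as the variable and `q` written as `p + 1#`, the identity contains no subtraction
    -- and holds in every commutative semiring.
    q * q ^ n                          ≈⟨ *-cong q≈p+1 (^-[] n) ⟩
    (p + 1#) * (1# + p * [ n ])        ≈⟨ solve 2 (λ p n → (p :+ con 1) :* (con 1 :+ p :* n)
                                            := con 1 :+ p :* (con 1 :+ (p :+ con 1) :* n)) refl p [ n ] ⟩
    1# + p * (1# + (p + 1#) * [ n ])   ≈⟨ +-congˡ (*-congˡ (+-congˡ (*-congʳ q≈p+1))) ⟨
    1# + p * [ suc n ]                 ∎
    where
    p : Carrier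
    p = q - 1#
    q≈p+1 : q ≈ p + 1#
    q≈p+1 = sym (x-y+y≈x q 1#)

  ^-∼1 : ∀ {p} n → p ∣ [ n ] → p ∣ q ^ n - 1#
  ^-∼1 {p} n p∣[n] = ∼-trans (∼-reflexive (^-[] n))
    (∼-trans (∼-+ ∼-refl (∣⇒∼0 (x∣ʳy⇒x∣ʳzy (q - 1#) p∣[n]))) (∼-reflexive (+-identityʳ 1#)))
    where open Modulo p

  -- A relation `g + y n = x m` becomes `[x m] = [g] + q^g [y n]`, and `[x m]`, `[y n]` are
  -- multiples of `[m]`, `[n]`. So `[g] z` is a difference of two multiples of `e`.
  ∣-bezout : ∀ {g m n z e} → Bézout.Identity g m n → e ∣ [ m ] * z → e ∣ [ n ] * z → e ∣ [ g ] * z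
  ∣-bezout {g} {m} {n} {z} {e} (Bézout.+- x y eq) e∣mz e∣nz =
    ∣-+-cancelʳ (∣ʳ-respʳ-≈ lemma (multiple m x e∣mz))
                (x∣ʳy⇒x∣ʳzy (q ^ g) (multiple n y e∣nz))
    where
    multiple : ∀ m x → e ∣ [ m ] * z → e ∣ [ x ℕ.* m ] * z
    multiple m x e∣mz = ∣ʳ-trans e∣mz (x∣ʳy⇒xz∣ʳyz z ([m]∣[n*m] m x))
    lemma : [ x ℕ.* m ] * z ≈ [ g ] * z + q ^ g * ([ y ℕ.* n ] * z)
    lemma = begin
      [ x ℕ.* m ] * z                                ≡⟨ ≡.cong (λ k → [ k ] * z) eq ⟨
      [ g ℕ.+ y ℕ.* n ] * z                          ≈⟨ *-congʳ ([]-+ g (y ℕ.* n)) ⟩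
      ([ g ] + q ^ g * [ y ℕ.* n ]) * z              ≈⟨ distribʳ z _ _ ⟩
      [ g ] * z + q ^ g * [ y ℕ.* n ] * z            ≈⟨ +-congˡ (*-assoc _ _ _) ⟩
      [ g ] * z + q ^ g * ([ y ℕ.* n ] * z)          ∎
  ∣-bezout {g} {m} {n} (Bézout.-+ x y eq) e∣mz e∣nz =
    ∣-bezout {m = n} {m} (Bézout.+- y x eq) e∣nz e∣mz

  ∣-gcd : ∀ m n {z e} → e ∣ [ m ] * z → e ∣ [ n ] * z → e ∣ [ gcd m n ] * z
  ∣-gcd m n = ∣-bezout {m = m} {n} (Bézout.identity (gcd-GCD m n))

  binom-zero : ∀ {n k} → n ℕ.< k → binom n k ≈ 0#
  binom-zero {zero}  {suc k} _ = refl
  binom-zero {suc n} {suc k} (s≤s n<k) = trans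
    (+-cong (binom-zero n<k) (*-congˡ (binom-zero (ℕₚ.<-trans n<k (ℕₚ.n<1+n k)))))
    (trans (+-identityˡ _) (zeroʳ _))

  binom-diag : ∀ n → binom n n ≈ 1#
  binom-diag zero    = refl
  binom-diag (suc n) = trans
    (+-cong (binom-diag n) (*-congˡ (binom-zero (ℕₚ.n<1+n n))))
    (trans (+-congˡ (zeroʳ _)) (+-identityʳ 1#))

  -- The binomial coefficient with i + j on top, for which absorption and symmetry
  -- are statements about the two arguments i and j.
  multinom : ℕ → ℕ → Carrier
  multinom i j = binom (i ℕ.+ j) i

  multinom-zeroʳ : ∀ i → multinom i 0 ≈ 1#
  multinom-zeroʳ i rewrite ℕₚ.+-identityʳ i = binom-diag i

  multinom-suc : ∀ i j → multinom (suc i) (suc j) ≈ multinom i (suc j) + q ^ suc i * multinom (suc i) j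
  multinom-suc i j = +-congˡ (*-congˡ (reflexive (≡.cong (λ n → binom n (suc i)) (ℕₚ.+-suc i j))))

  -- A joint induction on `i + j`. Pascal's rule splits the left side in two, the exchange law for
  -- the smaller total turns both parts into multiples of one coefficient, and `[]-+` adds the
  -- factors.
  multinom-absorbˡ : ∀ i j → [ suc i ] * multinom (suc i) j ≈ [ suc (i ℕ.+ j) ] * multinom i j
  multinom-absorbʳ : ∀ i j → [ suc j ] * multinom i (suc j) ≈ [ suc (i ℕ.+ j) ] * multinom i j
  multinom-exchange : ∀ i j → [ suc i ] * multinom (suc i) j ≈ [ suc j ] * multinom i (suc j)

  multinom-absorbˡ i zero = *-cong (reflexive (≡.cong [_] (≡.cong suc (≡.sym (ℕₚ.+-identityʳ i)))))
    (trans (multinom-zeroʳ (suc i)) (sym (multinom-zeroʳ i)))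
  multinom-absorbˡ i (suc j) = begin
    [ suc i ] * multinom (suc i) (suc j)
      ≈⟨ *-congˡ (multinom-suc i j) ⟩
    [ suc i ] * (x + q ^ suc i * y)
      ≈⟨ solve 4 (λ i x p y → i :* (x :+ p :* y) := i :* x :+ p :* (i :* y)) refl [ suc i ] x (q ^ suc i) y ⟩
    [ suc i ] * x + q ^ suc i * ([ suc i ] * y)
      ≈⟨ +-congˡ (*-congˡ (multinom-exchange i j)) ⟩
    [ suc i ] * x + q ^ suc i * ([ suc j ] * x)
      ≈⟨ solve 4 (λ i x p j → i :* x :+ p :* (j :* x) := (i :+ p :* j) :* x) refl [ suc i ] x (q ^ suc i) [ suc j ] ⟩
    ([ suc i ] + q ^ suc i * [ suc j ]) * x
      ≈⟨ *-congʳ ([]-+ (suc i) (suc j)) ⟨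
    [ suc (i ℕ.+ suc j) ] * x ∎
    where
    x y : Carrier
    x = multinom i (suc j)
    y = multinom (suc i) j

  multinom-absorbʳ zero    j = refl
  multinom-absorbʳ (suc i) j = begin
    [ suc j ] * multinom (suc i) (suc j)
      ≈⟨ *-congˡ (multinom-suc i j) ⟩
    [ suc j ] * (x + q ^ suc i * y)
      ≈⟨ solve 4 (λ j x p y → j :* (x :+ p :* y) := j :* x :+ p :* (j :* y)) refl [ suc j ] x (q ^ suc i) y ⟩
    [ suc j ] * x + q ^ suc i * ([ suc j ] * y)
      ≈⟨ +-congʳ (multinom-exchange i j) ⟨
    [ suc i ] * y + q ^ suc i * ([ suc j ] * y)
      ≈⟨ solve 4 (λ i y p j → i :* y :+ p :* (j :* y) := (i :+ p :* j) :* y) refl [ suc i ] y (q ^ suc i) [ suc j ] ⟩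
    ([ suc i ] + q ^ suc i * [ suc j ]) * y
      ≈⟨ *-congʳ ([]-+ (suc i) (suc j)) ⟨
    [ suc i ℕ.+ suc j ] * y
      ≡⟨ ≡.cong (λ n → [ n ] * y) (ℕₚ.+-suc (suc i) j) ⟩
    [ suc (suc i ℕ.+ j) ] * y ∎
    where
    x y : Carrier
    x = multinom i (suc j)
    y = multinom (suc i) j

  multinom-exchange i j = trans (multinom-absorbˡ i j) (sym (multinom-absorbʳ i j))

  -- Pascal's rule `x + q^(i+1) y` favours one argument. Writing `q^(i+1)` as `1 + (q - 1)[i+1]`
  -- gives `x + y` plus `(q - 1)[i+1] y`, and the exchange law makes the last term symmetric too.
  multinom-sym : ∀ i j → multinom i j ≈ multinom j i
  multinom-sym zero    j       = sym (multinom-zeroʳ j)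
  multinom-sym (suc i) zero    = multinom-zeroʳ (suc i)
  multinom-sym (suc i) (suc j) = begin
    multinom (suc i) (suc j)               ≈⟨ multinom-suc i j ⟩
    x + q ^ suc i * y                      ≈⟨ expand x (suc i) y ⟩
    x + y + p * ([ suc i ] * y)            ≈⟨ +-cong (+-comm x y) (*-congˡ (multinom-exchange i j)) ⟩
    y + x + p * ([ suc j ] * x)            ≈⟨ expand y (suc j) x ⟨
    y + q ^ suc j * x                      ≈⟨ +-cong (multinom-sym (suc i) j)
                                                     (*-congˡ (multinom-sym i (suc j))) ⟩
    multinom j (suc i) + q ^ suc j * multinom (suc j) i ≈⟨ multinom-suc j i ⟨
    multinom (suc j) (suc i)               ∎
    where
    p x y : Carrier
    p = q - 1#
    x = multinom i (suc j)
    y = multinom (suc i) j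
    expand : ∀ x i y → x + q ^ i * y ≈ x + y + p * ([ i ] * y)
    expand x i y = trans (+-congˡ (*-congʳ (^-[] i)))
      (solve 4 (λ x p n y → x :+ (con 1 :+ p :* n) :* y := x :+ y :+ p :* (n :* y)) refl x p [ i ] y)

  binom-absorb : ∀ n k → [ suc k ] * binom (suc n) (suc k) ≈ [ suc n ] * binom n k
  binom-absorb n k with k ℕ.≤? n
  ... | yes k≤n = ≡.subst (λ n → [ suc k ] * binom (suc n) (suc k) ≈ [ suc n ] * binom n k)
                    (ℕₚ.m+[n∸m]≡n k≤n) (multinom-absorbˡ k (n ℕ.∸ k))
  ... | no  k≰n = trans (*-congˡ (binom-zero (s≤s (ℕₚ.≰⇒> k≰n))))
                    (trans (zeroʳ _) (sym (trans (*-congˡ (binom-zero (ℕₚ.≰⇒> k≰n))) (zeroʳ _))))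

  binom-sym : ∀ i j {n} → i ℕ.+ j ≡ n → binom n i ≈ binom n j
  binom-sym i j ≡.refl = trans (multinom-sym i j)
    (reflexive (≡.cong (λ n → binom n j) (ℕₚ.+-comm j i)))

  -- The q-Lucas congruence

  module Lucas (p : Carrier) (d′ : ℕ) (p∣[d] : p ∣ [ suc d′ ])
               (p∣binom : ∀ i → 0 ℕ.< i → i ℕ.< suc d′ → p ∣ binom (suc d′) i) where
    open Modulo p

    private
      d : ℕ
      d = suc d′
      shift : ∀ v m → v ℕ.+ suc m ℕ.* d ≡ v ℕ.+ m ℕ.* d ℕ.+ d
      shift v m = ≡.trans (≡.cong (v ℕ.+_) (ℕₚ.+-comm d (m ℕ.* d))) (≡.sym (ℕₚ.+-assoc v (m ℕ.* d) d))

    ^-∼ : ∀ k → q ^ (k ℕ.+ d) ∼ q ^ k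
    ^-∼ zero    = ^-∼1 d p∣[d]
    ^-∼ (suc k) = ∼-*ˡ q (^-∼ k)

    -- Modulo `p`, row `d` begins `1, 0, ..., 0` just as row 0 does, and Pascal's rule carries the
    -- agreement to later rows.
    binom-periodˡ : ∀ n k → k ℕ.< d → binom (n ℕ.+ d) k ∼ binom n k
    binom-periodˡ n       zero    _   = ∼-refl
    binom-periodˡ zero    (suc k) k<d = ∣⇒∼0 (p∣binom (suc k) (s≤s z≤n) k<d)
    binom-periodˡ (suc n) (suc k) k<d = ∼-+
      (binom-periodˡ n k (ℕₚ.<-trans (ℕₚ.n<1+n k) k<d))
      (∼-*ˡ (q ^ suc k) (binom-periodˡ n (suc k) k<d))

    -- Modulo `p`, row `d` is 1 in columns `0` and `d` and 0 elsewhere, so going down `d` rows adds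
    -- to the triangle its copy moved by `d` columns; `q^d ≡ 1` keeps Pascal's rule the same for the
    -- copy.
    binom-period : ∀ n k → binom (n ℕ.+ d) (k ℕ.+ d) ∼ binom n k + binom n (k ℕ.+ d)
    binom-period zero zero = ∼-reflexive (trans (binom-diag d) (sym (+-identityʳ 1#)))
    binom-period zero (suc k) = ∼-reflexive
      (trans (binom-zero {d} {suc k ℕ.+ d} (s≤s (ℕₚ.m≤n+m d k))) (sym (+-identityʳ 0#)))
    -- Pascal's rule for column `d` refers to column `d′`, which is not of the form `k + d`;
    -- `binom-periodˡ` covers it.
    binom-period (suc n) zero = ∼-trans
      (∼-+ (binom-periodˡ n d′ (ℕₚ.n<1+n d′))
           (∼-* ∼-refl (binom-period n zero)))
      (∼-trans (∼-+ ∼-refl (∼-trans (∼-reflexive (distribˡ _ _ _))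
                                   (∼-+ (∼-trans (∼-*ʳ 1# (^-∼1 d p∣[d])) (∼-reflexive (*-identityˡ 1#))) ∼-refl)))
        (∼-reflexive (solve 2 (λ x y → x :+ (con 1 :+ y) := con 1 :+ (x :+ y)) refl _ _)))
    binom-period (suc n) (suc k) = ∼-trans
      (∼-+ (binom-period n k) (∼-* (^-∼ (suc k)) (binom-period n (suc k))))
      (∼-trans (∼-reflexive (solve 5 (λ x y p z w → (x :+ y) :+ p :* (z :+ w)
                               := (x :+ p :* z) :+ (y :+ p :* w)) refl _ _ _ _ _))
        (∼-+ ∼-refl (∼-+ ∼-refl (∼-*ʳ _ (∼-sym (^-∼ (suc k)))))))

    -- The `c` built here obeys Pascal's rule for the ordinary binomial coefficient of `m` over `u`.
    -- What is used of it is that it does not depend on `v` and `w`.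
    binom-lucas : ∀ m u → ∃ λ c → ∀ v w → v ℕ.< d → w ℕ.< d →
                  binom (v ℕ.+ m ℕ.* d) (w ℕ.+ u ℕ.* d) ∼ c * binom v w
    binom-lucas zero zero = 1# , λ v w v<d w<d → ∼-reflexive (trans
      (reflexive (≡.cong₂ binom (ℕₚ.+-identityʳ v) (ℕₚ.+-identityʳ w))) (sym (*-identityˡ _)))
    binom-lucas zero (suc u) = 0# , λ v w v<d w<d → ∼-reflexive (trans
      (binom-zero (ℕₚ.<-≤-trans (≡.subst (ℕ._< d) (≡.sym (ℕₚ.+-identityʳ v)) v<d)
        (ℕₚ.≤-trans (ℕₚ.m≤m+n d (u ℕ.* d)) (ℕₚ.m≤n+m _ w))))
      (sym (zeroˡ _)))
    binom-lucas (suc m) zero with binom-lucas m zero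
    ... | c , ih = c , λ v w v<d w<d → ∼-trans
      (∼-reflexive (reflexive (≡.cong₂ binom (shift v m) (ℕₚ.+-identityʳ w))))
      (∼-trans (binom-periodˡ (v ℕ.+ m ℕ.* d) w w<d)
        (∼-trans (∼-reflexive (reflexive (≡.cong (binom (v ℕ.+ m ℕ.* d)) (≡.sym (ℕₚ.+-identityʳ w)))))
          (ih v w v<d w<d)))
    binom-lucas (suc m) (suc u) with binom-lucas m u | binom-lucas m (suc u)
    ... | c₁ , ih₁ | c₂ , ih₂ = c₁ + c₂ , λ v w v<d w<d → ∼-trans
      (∼-reflexive (reflexive (≡.cong₂ binom (shift v m) (shift w u))))
      (∼-trans (binom-period (v ℕ.+ m ℕ.* d) (w ℕ.+ u ℕ.* d))
        (∼-trans (∼-+ (ih₁ v w v<d w<d)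
                      (∼-trans (∼-reflexive (reflexive (≡.cong (binom (v ℕ.+ m ℕ.* d)) (≡.sym (shift w u)))))
                               (ih₂ v w v<d w<d)))
          (∼-reflexive (sym (distribʳ _ c₁ c₂)))))

-- Cofactors and the factorization of `[3e]`

module Divisibility {c ℓ} (R : CommutativeRing c ℓ) (q : CommutativeRing.Carrier R) where
  open CommutativeRing R hiding (zero)
  open import Algebra.Properties.Semiring.Divisibility semiring
  open import Algebra.Properties.CommutativeSemigroup.Divisibility *-commutativeSemigroup
    using (x∣y⇒zx∣zy; x∣xy)
  open import Algebra.Properties.Semiring.Exp semiring using (_^_)
  open import Algebra.Properties.Ring ring
  open import Algebra.Solver.Ring.NaturalCoefficients.Default commutativeSemiring
  open import Relation.Binary.Reasoning.Setoid setoid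
  open Congruence R
  open Sums R
  open QAnalogue R q

  module _
    (cancel  : ∀ n → 0 ℕ.< n → ∀ x → [ n ] * x ≈ 0# → x ≈ 0#)
    (torsion : ∀ n → 0 ℕ.< n → ∀ x → [ n ] ∣ (1# + (1# + 1#)) * x → [ n ] ∣ x)
    where

    []-cancelˡ : ∀ n → 0 ℕ.< n → ∀ {x y} → [ n ] * x ≈ [ n ] * y → x ≈ y
    []-cancelˡ n 0<n {x} {y} eq = x∙y⁻¹≈ε⇒x≈y x y (cancel n 0<n (x - y)
      (trans (x[y-z]≈xy-xz [ n ] x y) (x≈y⇒x∙y⁻¹≈ε eq)))

    []-cancel-∣ : ∀ n → 0 ℕ.< n → ∀ {x y} → [ n ] * x ∣ [ n ] * y → x ∣ y
    []-cancel-∣ n 0<n {x} (z , eq) = z , []-cancelˡ n 0<n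
      (trans (solve 3 (λ n z x → n :* (z :* x) := z :* (n :* x)) refl [ n ] z x) eq)

    -- When `e` divides `[ n ]`, the second premise is automatic, and this is cancellation of
    -- `[ m ]` modulo `e`.
    ∣-coprime : ∀ m n {e z} → gcd m n ≡ 1 → e ∣ [ m ] * z → e ∣ [ n ] * z → e ∣ z
    ∣-coprime m n {e} {z} gcd≡1 e∣mz e∣nz = ∣ʳ-respʳ-≈
      (trans (*-congʳ (reflexive (≡.cong [_] gcd≡1)))
        (solve 2 (λ q z → (con 1 :+ q :* con 0) :* z := z) refl q z))
      (∣-gcd m n e∣mz e∣nz)

    [d]∣binom : ∀ {n d k} → d ℕ∣.∣ suc n → gcd (suc k) d ≡ 1 → [ d ] ∣ binom (suc n) (suc k)
    [d]∣binom {n} {d} {k} d∣n gcd≡1 = ∣-coprime (suc k) d gcd≡1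
      (∣ʳ-respʳ-≈ (sym (binom-absorb n k)) (∣-*ʳ (binom n k) ([]-mono-∣ d∣n)))
      (x∣xy [ d ] _)

    -- Used twice: with top `2N` and divisor `P` it gives `F`; with top and divisor both `3ʲ⁺¹`,
    -- hence `E = 1#`, it gives `G`.
    module Cofactor (n d : ℕ) (0<d : 0 ℕ.< d) (d∣n : d ℕ∣.∣ suc n) (E : Carrier) (E[d]≈[n] : E * [ d ] ≈ [ suc n ])
                    (∤3⇒gcd≡1 : ∀ {k} → ¬ 3 ℕ∣.∣ k → gcd k d ≡ 1) where
      abstract
        cofactor : ∀ k → ∃ λ F → ¬ 3 ℕ∣.∣ k → [ d ] * F ≈ binom (suc n) k
        cofactor k with 3 ℕ∣.∣? k
        -- An arbitrary value: such a term is later multiplied by `ε k`, which vanishes.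
        ... | yes 3∣k = 0# , λ 3∤k → contradiction 3∣k 3∤k
        cofactor zero | no 3∤0 = contradiction (3 ℕ∣.∣0) 3∤0
        cofactor (suc k) | no 3∤k with [d]∣binom {n} {d} {k} d∣n (∤3⇒gcd≡1 3∤k)
        ... | F , eq = F , λ _ → trans (*-comm [ d ] F) eq

      F : ℕ → Carrier
      F k = proj₁ (cofactor k)

      [d]F≈binom : ∀ {k} → ¬ 3 ℕ∣.∣ k → [ d ] * F k ≈ binom (suc n) k
      [d]F≈binom {k} = proj₂ (cofactor k)

      F-absorb : ∀ k → ¬ 3 ℕ∣.∣ suc k → [ suc k ] * F (suc k) ≈ E * binom n k
      F-absorb k 3∤k = []-cancelˡ d 0<d (begin
        [ d ] * ([ suc k ] * F (suc k))
          ≈⟨ solve 3 (λ d k g → d :* (k :* g) := k :* (d :* g)) refl [ d ] [ suc k ] _ ⟩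
        [ suc k ] * ([ d ] * F (suc k))
          ≈⟨ *-congˡ ([d]F≈binom 3∤k) ⟩
        [ suc k ] * binom (suc n) (suc k)
          ≈⟨ binom-absorb n k ⟩
        [ suc n ] * binom n k
          ≈⟨ *-congʳ E[d]≈[n] ⟨
        E * [ d ] * binom n k
          ≈⟨ solve 3 (λ E p b → E :* p :* b := p :* (E :* b)) refl E [ d ] _ ⟩
        [ d ] * (E * binom n k) ∎)

    -- The trinomial 1 + qᵉ + q²ᵉ = [3e]/[e]; for e = 3ʲ it is the cyclotomic polynomial of
    -- order 3ʲ⁺¹.
    Φ : ℕ → Carrier
    Φ e = 1# + q ^ e * (1# + q ^ e)

    [3e]≈[e]Φ : ∀ e → [ 3 ℕ.* e ] ≈ [ e ] * Φ e
    [3e]≈[e]Φ e = begin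
      [ e ℕ.+ (e ℕ.+ (e ℕ.+ 0)) ]
        ≈⟨ []-+ e _ ⟩
      [ e ] + q ^ e * [ e ℕ.+ (e ℕ.+ 0) ]
        ≈⟨ +-congˡ (*-congˡ ([]-+ e _)) ⟩
      [ e ] + q ^ e * ([ e ] + q ^ e * [ e ℕ.+ 0 ])
        ≡⟨ ≡.cong (λ n → [ e ] + q ^ e * ([ e ] + q ^ e * [ n ])) (ℕₚ.+-identityʳ e) ⟩
      [ e ] + q ^ e * ([ e ] + q ^ e * [ e ])
        ≈⟨ solve 2 (λ e p → e :+ p :* (e :+ p :* e) := e :* (con 1 :+ p :* (con 1 :+ p))) refl [ e ] (q ^ e) ⟩
      [ e ] * Φ e ∎

    -- Φ e ≡ 3 modulo [e], so [e] and Φ e are coprime up to 3-torsion.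
    [3e]∣ : ∀ e → 0 ℕ.< e → ∀ {x} → [ e ] ∣ x → Φ e ∣ x → [ 3 ℕ.* e ] ∣ x
    [3e]∣ e 0<e {x} [e]∣x Φ∣x = torsion (3 ℕ.* e) (ℕₚ.<-≤-trans 0<e (ℕₚ.m≤n*m e 3)) x
      -- `[3e]` divides `Φ e * x` because `[ e ]` divides `x`, and `[ e ] * x` because `Φ e` divides
      -- `x`. The combination `Φ e * x - y * ([ e ] * x)` is `3x`.
      (∣-+-cancelʳ (∣ʳ-respʳ-≈ Φx≈ (∣ʳ-respˡ-≈ (sym (trans ([3e]≈[e]Φ e) (*-comm _ _))) (x∣y⇒zx∣zy (Φ e) [e]∣x)))
        (∣ʳ-respˡ-≈ (sym ([3e]≈[e]Φ e)) (x∣ʳy⇒x∣ʳzy y (x∣y⇒zx∣zy [ e ] Φ∣x))))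
      where
      p y : Carrier
      p = q - 1#
      -- From `1 + t + t² = 3 + y [e]` at `t = q^e = 1 + p [e]`.
      y = (1# + (1# + 1#)) * p + p * p * [ e ]
      Φx≈ : Φ e * x ≈ (1# + (1# + 1#)) * x + y * ([ e ] * x)
      Φx≈ = trans (*-congʳ (+-congˡ (*-cong (^-[] e) (+-congˡ (^-[] e)))))
        (solve 3 (λ p n x → (con 1 :+ (con 1 :+ p :* n) :* (con 1 :+ (con 1 :+ p :* n))) :* x
          := (con 1 :+ (con 1 :+ con 1)) :* x
             :+ ((con 1 :+ (con 1 :+ con 1)) :* p :+ p :* p :* n) :* (n :* x)) refl p [ e ] x)

    -- Divisibility by a single cyclotomic factor

    module CyclotomicLevel (j h : ℕ) (d≡ : 3 ℕ.^ suc j ≡ suc (h ℕ.+ h)) where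
      private
        e d′ d : ℕ
        e = 3 ℕ.^ j
        d′ = h ℕ.+ h
        d = suc d′
        φ : Carrier
        φ = Φ e
        0<e : 0 ℕ.< e
        0<e = ℕₚ.m^n>0 3 j
        0<d : 0 ℕ.< d
        0<d = s≤s z≤n

      [d]≈[e]φ : [ d ] ≈ [ e ] * φ
      [d]≈[e]φ = trans (reflexive (≡.cong [_] (≡.sym d≡))) ([3e]≈[e]Φ e)

      φ∣[d] : φ ∣ [ d ]
      φ∣[d] = [ e ] , sym [d]≈[e]φ

      -- By absorption `[d]` divides `[i] binom d i`, hence also `[gcd i d] binom d i`. As `i < d`,
      -- the gcd is a proper divisor of a power of 3 and divides `e`; so `[e] φ` divides
      -- `[e] binom d i`, and `[e]` cancels.
      φ∣binom : ∀ i → 0 ℕ.< i → i ℕ.< d → φ ∣ binom d i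
      φ∣binom i@(suc i′) _ i<d = []-cancel-∣ e 0<e (∣ʳ-respˡ-≈ [d]≈[e]φ
        (∣ʳ-trans
          (∣-gcd i d (∣ʳ-respʳ-≈ (sym (binom-absorb d′ i′)) (x∣xy [ d ] (binom d′ i′))) (x∣xy [ d ] _))
          (x∣ʳy⇒xz∣ʳyz (binom d i) ([]-mono-∣ g∣e))))
        where
        g∣e : gcd i d ℕ∣.∣ e
        g∣e with ∣prime-power 3-prime j (≡.subst (gcd i d ℕ∣.∣_) (≡.sym d≡) (gcd[m,n]∣n i d))
        ... | inj₂ g∣e = g∣e
        ... | inj₁ g≡  = contradiction (ℕ∣.∣⇒≤ (gcd[m,n]∣m i d))
          (ℕₚ.<⇒≱ (≡.subst (i ℕ.<_) (≡.trans (≡.sym d≡) (≡.sym g≡)) i<d))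

      open Modulo φ
      open Lucas φ d′ φ∣[d] φ∣binom

      ∤3⇒gcd≡1 : ∀ {k} → ¬ 3 ℕ∣.∣ k → gcd k d ≡ 1
      ∤3⇒gcd≡1 {k} 3∤k = ≡.trans (≡.cong (gcd k) (≡.sym d≡)) (∤3⇒coprime 3∤k (suc j))

      ∼-cancel : ∀ {k x y} → ¬ 3 ℕ∣.∣ k → [ k ] * x ∼ [ k ] * y → x ∼ y
      ∼-cancel {k} {x} {y} 3∤k kx∼ky = ∣-coprime k d (∤3⇒gcd≡1 3∤k)
        (∣ʳ-respʳ-≈ (sym (x[y-z]≈xy-xz [ k ] x y)) kx∼ky)
        (∣-*ʳ (x - y) φ∣[d])

      open Cofactor d′ d 0<d ℕ∣.∣-refl 1# (*-identityˡ [ d ]) ∤3⇒gcd≡1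
        renaming (F to G; F-absorb to G-absorb; [d]F≈binom to [d]G≈binom)

      G-sym : ∀ r s → r ℕ.+ s ≡ d → ¬ 3 ℕ∣.∣ r → ¬ 3 ℕ∣.∣ s → G r ≈ G s
      G-sym r s r+s≡d 3∤r 3∤s = []-cancelˡ d 0<d (begin
        [ d ] * G r  ≈⟨ [d]G≈binom 3∤r ⟩
        binom d r    ≈⟨ binom-sym r s r+s≡d ⟩
        binom d s    ≈⟨ [d]G≈binom 3∤s ⟨
        [ d ] * G s  ∎)

      3∣d : 3 ℕ∣.∣ d
      3∣d = ≡.subst (3 ℕ∣.∣_) d≡ (ℕ∣.m∣m*n e)

      module _
        (ε : ℕ → Carrier)
        (ε-zero : ∀ k → 3 ℕ∣.∣ k → ε k ≈ 0#)
        (ε-anti : ∀ r s → r ℕ.+ s ≡ d → φ ∣ ε r + ε s)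
        where

        τ : ℕ → Carrier
        τ k = ε k * G k

        φ∣∑τ : φ ∣ ∑ d τ
        -- Index 0 has no partner within the block but contributes nothing; the other `h + h`
        -- indices are paired by `r ↦ d - r`.
        φ∣∑τ = ∣-+ (∣ʳ-respʳ-≈ (sym (trans (*-congʳ (ε-zero 0 (3 ℕ∣.∣0))) (zeroˡ (G 0)))) (φ ∣0))
          (∣-∑-antisymmetric φ h (λ i → τ (suc i)) λ r s eq → pair (suc r) (suc s)
            (≡.cong suc (≡.trans (ℕₚ.+-suc r s) eq)))
          where
          pair : ∀ r s → r ℕ.+ s ≡ d → φ ∣ τ r + τ s
          pair r s r+s≡d with 3 ℕ∣.∣? r
          ... | yes 3∣r = ∣ʳ-respʳ-≈ (sym (trans
                  (+-cong (trans (*-congʳ (ε-zero r 3∣r)) (zeroˡ _))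
                          (trans (*-congʳ (ε-zero s 3∣s)) (zeroˡ _))) (+-identityʳ 0#))) (φ ∣0)
            where
            3∣s : 3 ℕ∣.∣ s
            3∣s = ℕ∣.∣m+n∣m⇒∣n (≡.subst (3 ℕ∣.∣_) (≡.sym r+s≡d) 3∣d) 3∣r
          ... | no 3∤r = ∣ʳ-respʳ-≈
                  (trans (distribʳ (G r) (ε r) (ε s)) (+-congˡ (*-congˡ (G-sym r s r+s≡d 3∤r 3∤s))))
                  (∣-*ʳ (G r) (ε-anti r s r+s≡d))
            where
            3∤s : ¬ 3 ℕ∣.∣ s
            3∤s 3∣s = 3∤r (ℕ∣.∣m+n∣m⇒∣n
              (≡.subst (3 ℕ∣.∣_) (≡.trans (≡.sym r+s≡d) (ℕₚ.+-comm r s)) 3∣d) 3∣s)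

        module _
          (m : ℕ) (E : Carrier) (F : ℕ → Carrier)
          (ε-period : ∀ r u → ε (r ℕ.+ u ℕ.* d) ∼ ε r)
          (F-absorb : ∀ k → ¬ 3 ℕ∣.∣ suc k → [ suc k ] * F (suc k) ≈ E * binom (d′ ℕ.+ m ℕ.* d) k)
          where

          φ∣block : ∀ u → φ ∣ ∑ d (λ r → ε (r ℕ.+ u ℕ.* d) * F (r ℕ.+ u ℕ.* d))
          φ∣block u = ∼0⇒∣ (∼-trans (∑-∼ φ d λ r r<d → term r r<d (3 ℕ∣.∣? r))
            (∣⇒∼0 (∣ʳ-respʳ-≈ (sym (∑-*ˡ d (E * C) τ)) (x∣ʳy⇒x∣ʳzy (E * C) φ∣∑τ))))
            where
            lucas : ∃ λ c → ∀ v w → v ℕ.< d → w ℕ.< d →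
                    binom (v ℕ.+ m ℕ.* d) (w ℕ.+ u ℕ.* d) ∼ c * binom v w
            lucas = binom-lucas m u
            C : Carrier
            C = proj₁ lucas
            F∼ : ∀ r → ¬ 3 ℕ∣.∣ r → ¬ 3 ℕ∣.∣ r ℕ.+ u ℕ.* d → r ℕ.< d →
                 F (r ℕ.+ u ℕ.* d) ∼ E * C * G r
            F∼ zero    3∤r _   _   = contradiction (3 ℕ∣.∣0) 3∤r
            F∼ (suc r) 3∤r 3∤k r<d = ∼-cancel 3∤r (∼-trans
              (∼-*ʳ _ (∼-sym [k]∼[r]))
              (∼-trans (∼-reflexive (F-absorb (r ℕ.+ u ℕ.* d) 3∤k))
              -- The last base-`d` digit of the top is `d′`, so q-Lucas leaves `binom d′ r`, which
              -- is `[ suc r ] * G (suc r)` by absorption.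
              (∼-trans (∼-*ˡ E (proj₂ lucas d′ r (ℕₚ.n<1+n d′) (ℕₚ.<-trans (ℕₚ.n<1+n r) r<d)))
                (∼-reflexive (trans (*-congˡ (*-congˡ (sym (trans (G-absorb r 3∤r) (*-identityˡ _)))))
                  (solve 4 (λ E c k g → E :* (c :* (k :* g)) := k :* (E :* c :* g))
                    refl E C [ suc r ] (G (suc r))))))))
              where
              [k]∼[r] : [ suc r ℕ.+ u ℕ.* d ] ∼ [ suc r ]
              [k]∼[r] = ∼-trans (∼-reflexive ([]-+ (suc r) (u ℕ.* d)))
                (∼-trans (∼-+ ∼-refl (∣⇒∼0 (x∣ʳy⇒x∣ʳzy (q ^ suc r) (∣ʳ-trans φ∣[d] ([m]∣[n*m] d u)))))
                  (∼-reflexive (+-identityʳ _)))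
            term : ∀ r → r ℕ.< d → Dec (3 ℕ∣.∣ r) →
                   ε (r ℕ.+ u ℕ.* d) * F (r ℕ.+ u ℕ.* d) ∼ E * C * τ r
            term r r<d (yes 3∣r) = ∼-reflexive (trans
              (trans (*-congʳ (ε-zero _ (ℕ∣.∣m∣n⇒∣m+n 3∣r (ℕ∣.∣n⇒∣m*n u 3∣d)))) (zeroˡ _))
              (sym (trans (*-congˡ (trans (*-congʳ (ε-zero r 3∣r)) (zeroˡ _))) (zeroʳ _))))
            term r r<d (no 3∤r) = ∼-trans
              (∼-* (ε-period r u) (F∼ r 3∤r 3∤k r<d))
              (∼-reflexive (solve 3 (λ x b g → x :* (b :* g) := b :* (x :* g))
                refl (ε r) (E * C) (G r)))
              where
              3∤k : ¬ 3 ℕ∣.∣ r ℕ.+ u ℕ.* d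
              3∤k 3∣k = 3∤r (ℕ∣.∣m+n∣m⇒∣n
                (≡.subst (3 ℕ∣.∣_) (ℕₚ.+-comm r _) 3∣k) (ℕ∣.∣n⇒∣m*n u 3∣d))

    -- Combining the levels

    module _
      (a m : ℕ) (1≤m : 1 ℕ.≤ m) (ε : ℕ → Carrier)
      (ε-zero : ∀ k → 3 ℕ∣.∣ k → ε k ≈ 0#)
      (ε-anti : ∀ j → j ℕ.< a → ∀ r s → r ℕ.+ s ≡ 3 ℕ.^ suc j → [ 3 ℕ.^ suc j ] ∣ ε r + ε s)
      (ε-period : ∀ j → j ℕ.< a → ∀ r u → [ 3 ℕ.^ suc j ] ∣ ε (r ℕ.+ u ℕ.* 3 ℕ.^ suc j) - ε r)
      where

      -- Starting the sum at `k = 0`, where `ε` vanishes, makes its range a union of whole blocks of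
      -- length `3ʲ⁺¹` for every `j < a`.
      [P]²∣∑ : ∀ n → suc n ≡ 2 ℕ.* 3 ℕ.^ a ℕ.* m →
               [ 3 ℕ.^ a ] * [ 3 ℕ.^ a ] ∣ ∑ (3 ℕ.^ a ℕ.* m) (λ k → ε k * binom (suc n) k)
      [P]²∣∑ n n≡ = ∣ʳ-respʳ-≈ (sym ∑≈[P]∑)
          (∣ʳ-respʳ-≈ (*-comm _ _) (x∣ʳy⇒xz∣ʳyz [ P ] ([3^j]∣∑ a ℕₚ.≤-refl)))
        where
        P N : ℕ
        P = 3 ℕ.^ a
        N = P ℕ.* m
        P∣suc-n : P ℕ∣.∣ suc n
        P∣suc-n = ≡.subst (P ℕ∣.∣_) (≡.sym n≡) (ℕ∣.∣m⇒∣m*n m (ℕ∣.∣n⇒∣m*n 2 ℕ∣.∣-refl))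
        [P]∣ : [ P ] ∣ [ suc n ]
        [P]∣ = []-mono-∣ P∣suc-n
        E : Carrier
        E = _∣ʳ_.quotient [P]∣
        open Cofactor n P (ℕₚ.m^n>0 3 a) P∣suc-n E (_∣ʳ_.equality [P]∣) (λ 3∤k → ∤3⇒coprime 3∤k a)
        S : Carrier
        S = ∑ N (λ k → ε k * F k)
        ∑≈[P]∑ : ∑ N (λ k → ε k * binom (suc n) k) ≈ [ P ] * S
        ∑≈[P]∑ = trans (∑-cong N term) (∑-*ˡ N [ P ] _)
          where
          term : ∀ k → ε k * binom (suc n) k ≈ [ P ] * (ε k * F k)
          term k with 3 ℕ∣.∣? k
          ... | yes 3∣k = trans (trans (*-congʳ (ε-zero k 3∣k)) (zeroˡ _))
                  (sym (trans (*-congˡ (trans (*-congʳ (ε-zero k 3∣k)) (zeroˡ _))) (zeroʳ _)))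
          ... | no 3∤k = trans (*-congˡ (sym ([d]F≈binom 3∤k)))
                  (solve 3 (λ x p f → x :* (p :* f) := p :* (x :* f)) refl (ε k) [ P ] (F k))
        Φ∣S : ∀ j → j ℕ.< a → Φ (3 ℕ.^ j) ∣ S
        Φ∣S j j<a with 3^-odd (suc j) | ℕₚ.m≤n⇒∃[o]m+o≡n j<a
        ... | h , d≡ | i , ≡.refl = ≡.subst (λ N → φ ∣ ∑ N (λ k → ε k * F k)) (≡.sym N≡)
            (∣-∑-blocks φ blocks d _ (φ∣block ε ε-zero
              (λ r s eq → ∣ʳ-trans φ∣[3^] (ε-anti j j<a r s (≡.trans eq (≡.sym d≡))))
              M E F
              (λ r u → ∣ʳ-trans φ∣[3^] (≡.subst (λ d → [ 3 ℕ.^ suc j ] ∣ ε (r ℕ.+ u ℕ.* d) - ε r) d≡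
                (ε-period j j<a r u)))
              (λ k 3∤k → trans (F-absorb k 3∤k) (*-congˡ (reflexive (≡.cong (λ n → binom n k) n≡′))))))
          where
          open CyclotomicLevel j h d≡
          φ : Carrier
          φ = Φ (3 ℕ.^ j)
          d blocks M : ℕ
          d = suc (h ℕ.+ h)
          blocks = 3 ℕ.^ i ℕ.* m
          -- Since `2N = 2 * blocks * d`, borrowing one `d` gives `2N - 1 = (d - 1) + M * d`, the
          -- digits that q-Lucas reads.
          M = ℕ.pred (2 ℕ.* blocks)
          φ∣[3^] : φ ∣ [ 3 ℕ.^ suc j ]
          φ∣[3^] = ∣ʳ-respʳ-≈ (reflexive (≡.cong [_] (≡.sym d≡))) φ∣[d]
          N≡ : N ≡ blocks ℕ.* d
          N≡ = ≡.trans (≡.cong (ℕ._* m) (≡.trans (ℕₚ.^-distribˡ-+-* 3 (suc j) i) (≡.cong (ℕ._* 3 ℕ.^ i) d≡)))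
            (≡.trans (ℕₚ.*-assoc d (3 ℕ.^ i) m) (ℕₚ.*-comm d blocks))
          suc-M : suc M ≡ 2 ℕ.* blocks
          suc-M = ℕₚ.suc-pred (2 ℕ.* blocks)
            {{ℕ.>-nonZero (ℕₚ.*-mono-< {0} {2} {0} {blocks} (s≤s z≤n) (ℕₚ.*-mono-< (ℕₚ.m^n>0 3 i) 1≤m))}}
          n≡′ : n ≡ h ℕ.+ h ℕ.+ M ℕ.* d
          n≡′ = ℕₚ.suc-injective (≡.trans n≡ (≡.trans (ℕₚ.*-assoc 2 P m)
            (≡.trans (≡.cong (2 ℕ.*_) N≡) (≡.trans (≡.sym (ℕₚ.*-assoc 2 blocks d))
              (≡.cong (ℕ._* d) (≡.sym suc-M))))))
        [3^j]∣∑ : ∀ j → j ℕ.≤ a → [ 3 ℕ.^ j ] ∣ S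
        [3^j]∣∑ zero    _   = S , solve 2 (λ q s → s :* (con 1 :+ q :* con 0) := s) refl q S
        [3^j]∣∑ (suc j) j<a = [3e]∣ (3 ℕ.^ j) (ℕₚ.m^n>0 3 j)
          ([3^j]∣∑ j (ℕₚ.<⇒≤ j<a)) (Φ∣S j j<a)

-- The commutative ring of Laurent polynomials

open import Data.Integer as ℤ using (ℤ; +_; -[1+_]; -_; _-_; _≟_)
open ≡ using (refl; sym; trans; cong; cong₂; subst; module ≡-Reasoning)

coeff-∷ : ∀ e c f n → coeff ((e , c) ∷ f) n ≡ coeff ((e , c) ∷ []) n ℤ.+ coeff f n
coeff-∷ e c f n with e ≟ n
... | yes _ = cong (ℤ._+ coeff f n) (sym (ℤₚ.+-identityʳ c))
... | no  _ = sym (ℤₚ.+-identityˡ _)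

coeff-++ : ∀ f g n → coeff (f ++ g) n ≡ coeff f n ℤ.+ coeff g n
coeff-++ []            g n = sym (ℤₚ.+-identityˡ _)
coeff-++ ((e , c) ∷ f) g n with e ≟ n
... | yes _ = trans (cong (ℤ._+_ c) (coeff-++ f g n)) (sym (ℤₚ.+-assoc c _ _))
... | no  _ = coeff-++ f g n

coeff-·L : ∀ z f n → coeff (z ·L f) n ≡ z ℤ.* coeff f n
coeff-·L z []            n = sym (ℤₚ.*-zeroʳ z)
coeff-·L z ((e , c) ∷ f) n with e ≟ n
... | yes _ = trans (cong (ℤ._+_ (z ℤ.* c)) (coeff-·L z f n)) (sym (ℤₚ.*-distribˡ-+ z c _))
... | no  _ = coeff-·L z f n

-- h stands for the anonymous function in the definition of _*L_.
coeff-shift : ∀ e c (h : ℤ × ℤ → ℤ × ℤ) →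
  (∀ e′ c′ → h (e′ , c′) ≡ (e ℤ.+ e′ , c ℤ.* c′)) →
  ∀ g n → coeff (map h g) n ≡ c ℤ.* coeff g (n - e)
coeff-shift e c h h≡ []              n = sym (ℤₚ.*-zeroʳ c)
coeff-shift e c h h≡ ((e′ , c′) ∷ g) n rewrite h≡ e′ c′
  with e ℤ.+ e′ ≟ n | e′ ≟ n - e
... | yes _  | yes _  = trans (cong (ℤ._+_ (c ℤ.* c′)) (coeff-shift e c h h≡ g n))
                              (sym (ℤₚ.*-distribˡ-+ c c′ _))
... | no _   | no _   = coeff-shift e c h h≡ g n
... | yes eq | no neq = contradiction (trans (lemma e e′) (cong (_- e) eq)) neq
  where
  lemma : ∀ e e′ → e′ ≡ e ℤ.+ e′ - e
  lemma = ℤ-solver.solve-∀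
... | no neq | yes eq = contradiction (trans (cong (λ z → e ℤ.+ z) eq) (lemma e n)) neq
  where
  lemma : ∀ e n → e ℤ.+ (n - e) ≡ n
  lemma = ℤ-solver.solve-∀

coeff-∷-*L : ∀ e c f g n →
  coeff (((e , c) ∷ f) *L g) n ≡ c ℤ.* coeff g (n - e) ℤ.+ coeff (f *L g) n
coeff-∷-*L e c f g n = trans (coeff-++ (map _ g) (f *L g) n)
  (cong (ℤ._+ coeff (f *L g) n) (coeff-shift e c _ (λ _ _ → refl) g n))

coeff-qpow-*L : ∀ e g n → coeff (qpow e *L g) n ≡ coeff g (n - e)
coeff-qpow-*L e g n = trans (coeff-∷-*L e (+ 1) [] g n)
  (trans (ℤₚ.+-identityʳ _) (ℤₚ.*-identityˡ _))

monomial-swap : ∀ e c e′ c′ n →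
  c ℤ.* coeff ((e′ , c′) ∷ []) (n - e) ≡ c′ ℤ.* coeff ((e , c) ∷ []) (n - e′)
monomial-swap e c e′ c′ n with e′ ≟ n - e | e ≟ n - e′
... | yes _  | yes _  = lemma c c′
  where
  lemma : ∀ c c′ → c ℤ.* (c′ ℤ.+ + 0) ≡ c′ ℤ.* (c ℤ.+ + 0)
  lemma = ℤ-solver.solve-∀
... | no _   | no _   = trans (ℤₚ.*-zeroʳ c) (sym (ℤₚ.*-zeroʳ c′))
... | yes eq | no neq = contradiction (trans (lemma e n) (cong (λ z → n - z) (sym eq))) neq
  where
  lemma : ∀ e n → e ≡ n - (n - e)
  lemma = ℤ-solver.solve-∀
... | no neq | yes eq = contradiction (trans (lemma e′ n) (cong (λ z → n - z) (sym eq))) neq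
  where
  lemma : ∀ e n → e ≡ n - (n - e)
  lemma = ℤ-solver.solve-∀

*L-zeroʳ : ∀ f → f *L 0L ≈L 0L
*L-zeroʳ []            n = refl
*L-zeroʳ ((e , c) ∷ f) n = *L-zeroʳ f n

-- `_*L_` recurses on its left factor; commutativity needs the matching expansion along the right
-- one. The product of the two heads changes sides by `monomial-swap`.
coeff-*L-∷ : ∀ e c f g n →
  coeff (f *L ((e , c) ∷ g)) n ≡ c ℤ.* coeff f (n - e) ℤ.+ coeff (f *L g) n
coeff-*L-∷ e c []              g n = cong (ℤ._+ + 0) (sym (ℤₚ.*-zeroʳ c))
coeff-*L-∷ e c ((e′ , c′) ∷ f) g n = begin
  coeff (((e′ , c′) ∷ f) *L ((e , c) ∷ g)) n
    ≡⟨ coeff-∷-*L e′ c′ f _ n ⟩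
  c′ ℤ.* coeff ((e , c) ∷ g) (n - e′) ℤ.+ coeff (f *L ((e , c) ∷ g)) n
    ≡⟨ cong₂ (λ x y → c′ ℤ.* x ℤ.+ y) (coeff-∷ e c g (n - e′)) (coeff-*L-∷ e c f g n) ⟩
  c′ ℤ.* (m ℤ.+ b) ℤ.+ (c ℤ.* a ℤ.+ r)
    ≡⟨ cong (ℤ._+ (c ℤ.* a ℤ.+ r)) (ℤₚ.*-distribˡ-+ c′ m b) ⟩
  c′ ℤ.* m ℤ.+ c′ ℤ.* b ℤ.+ (c ℤ.* a ℤ.+ r)
    ≡⟨ cong (λ z → z ℤ.+ c′ ℤ.* b ℤ.+ (c ℤ.* a ℤ.+ r)) (monomial-swap e′ c′ e c n) ⟩
  c ℤ.* m′ ℤ.+ c′ ℤ.* b ℤ.+ (c ℤ.* a ℤ.+ r)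
    ≡⟨ lemma c c′ m′ a b r ⟩
  c ℤ.* (m′ ℤ.+ a) ℤ.+ (c′ ℤ.* b ℤ.+ r)
    ≡⟨ cong₂ (λ x y → c ℤ.* x ℤ.+ y) (coeff-∷ e′ c′ f (n - e)) (coeff-∷-*L e′ c′ f g n) ⟨
  c ℤ.* coeff ((e′ , c′) ∷ f) (n - e) ℤ.+ coeff (((e′ , c′) ∷ f) *L g) n ∎
  where
  open ≡-Reasoning
  m m′ a b r : ℤ
  m  = coeff ((e , c) ∷ []) (n - e′)
  m′ = coeff ((e′ , c′) ∷ []) (n - e)
  a  = coeff f (n - e)
  b  = coeff g (n - e′)
  r  = coeff (f *L g) n
  lemma : ∀ c c′ m a b r →
    c ℤ.* m ℤ.+ c′ ℤ.* b ℤ.+ (c ℤ.* a ℤ.+ r) ≡ c ℤ.* (m ℤ.+ a) ℤ.+ (c′ ℤ.* b ℤ.+ r)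
  lemma = ℤ-solver.solve-∀

*L-comm : ∀ f g → f *L g ≈L g *L f
*L-comm []            g n = sym (*L-zeroʳ g n)
*L-comm ((e , c) ∷ f) g n = begin
  coeff (((e , c) ∷ f) *L g) n                  ≡⟨ coeff-∷-*L e c f g n ⟩
  c ℤ.* coeff g (n - e) ℤ.+ coeff (f *L g) n    ≡⟨ cong (ℤ._+_ (c ℤ.* coeff g (n - e))) (*L-comm f g n) ⟩
  c ℤ.* coeff g (n - e) ℤ.+ coeff (g *L f) n    ≡⟨ coeff-*L-∷ e c g f n ⟨
  coeff (g *L ((e , c) ∷ f)) n                  ∎
  where open ≡-Reasoning

*L-congˡ : ∀ f {g g′} → g ≈L g′ → f *L g ≈L f *L g′
*L-congˡ []            g≈g′ n = refl
*L-congˡ ((e , c) ∷ f) {g} {g′} g≈g′ n = begin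
  coeff (((e , c) ∷ f) *L g) n
    ≡⟨ coeff-∷-*L e c f g n ⟩
  c ℤ.* coeff g (n - e) ℤ.+ coeff (f *L g) n
    ≡⟨ cong₂ (λ x y → c ℤ.* x ℤ.+ y) (g≈g′ (n - e)) (*L-congˡ f g≈g′ n) ⟩
  c ℤ.* coeff g′ (n - e) ℤ.+ coeff (f *L g′) n
    ≡⟨ coeff-∷-*L e c f g′ n ⟨
  coeff (((e , c) ∷ f) *L g′) n ∎
  where open ≡-Reasoning

-- Lists with equal coefficients need not match term by term, so the left factor is not replaced by
-- recursion on it but is moved to the right by commutativity.
*L-cong : ∀ {f f′ g g′} → f ≈L f′ → g ≈L g′ → f *L g ≈L f′ *L g′
*L-cong {f} {f′} {g} {g′} f≈f′ g≈g′ n = begin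
  coeff (f *L g) n    ≡⟨ *L-congˡ f g≈g′ n ⟩
  coeff (f *L g′) n   ≡⟨ *L-comm f g′ n ⟩
  coeff (g′ *L f) n   ≡⟨ *L-congˡ g′ f≈f′ n ⟩
  coeff (g′ *L f′) n  ≡⟨ *L-comm g′ f′ n ⟩
  coeff (f′ *L g′) n  ∎
  where open ≡-Reasoning

*L-distribʳ : ∀ h f g → (f +L g) *L h ≈L f *L h +L g *L h
*L-distribʳ h []            g n = refl
*L-distribʳ h ((e , c) ∷ f) g n = begin
  coeff (((e , c) ∷ (f ++ g)) *L h) n
    ≡⟨ coeff-∷-*L e c (f ++ g) h n ⟩
  x ℤ.+ coeff ((f ++ g) *L h) n
    ≡⟨ cong (ℤ._+_ x) (trans (*L-distribʳ h f g n) (coeff-++ (f *L h) (g *L h) n)) ⟩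
  x ℤ.+ (coeff (f *L h) n ℤ.+ coeff (g *L h) n)
    ≡⟨ ℤₚ.+-assoc x _ _ ⟨
  x ℤ.+ coeff (f *L h) n ℤ.+ coeff (g *L h) n
    ≡⟨ cong (ℤ._+ coeff (g *L h) n) (coeff-∷-*L e c f h n) ⟨
  coeff (((e , c) ∷ f) *L h) n ℤ.+ coeff (g *L h) n
    ≡⟨ coeff-++ (((e , c) ∷ f) *L h) (g *L h) n ⟨
  coeff (((e , c) ∷ f) *L h +L g *L h) n ∎
  where
  open ≡-Reasoning
  x : ℤ
  x = c ℤ.* coeff h (n - e)

monomial-*L-assoc : ∀ e c g h n →
  coeff ((((e , c) ∷ []) *L g) *L h) n ≡ c ℤ.* coeff (g *L h) (n - e)
monomial-*L-assoc e c []              h n = sym (ℤₚ.*-zeroʳ c)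
monomial-*L-assoc e c ((e′ , c′) ∷ g) h n = begin
  coeff (((e ℤ.+ e′ , c ℤ.* c′) ∷ (((e , c) ∷ []) *L g)) *L h) n
    ≡⟨ coeff-∷-*L (e ℤ.+ e′) (c ℤ.* c′) (((e , c) ∷ []) *L g) h n ⟩
  c ℤ.* c′ ℤ.* coeff h (n - (e ℤ.+ e′)) ℤ.+ coeff ((((e , c) ∷ []) *L g) *L h) n
    ≡⟨ cong₂ (λ x y → c ℤ.* c′ ℤ.* coeff h x ℤ.+ y) (lemma₁ n e e′) (monomial-*L-assoc e c g h n) ⟩
  c ℤ.* c′ ℤ.* coeff h (n - e - e′) ℤ.+ c ℤ.* coeff (g *L h) (n - e)
    ≡⟨ lemma₂ c c′ _ _ ⟩
  c ℤ.* (c′ ℤ.* coeff h (n - e - e′) ℤ.+ coeff (g *L h) (n - e))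
    ≡⟨ cong (c ℤ.*_) (coeff-∷-*L e′ c′ g h (n - e)) ⟨
  c ℤ.* coeff (((e′ , c′) ∷ g) *L h) (n - e) ∎
  where
  open ≡-Reasoning
  lemma₁ : ∀ n e e′ → n - (e ℤ.+ e′) ≡ n - e - e′
  lemma₁ = ℤ-solver.solve-∀
  lemma₂ : ∀ c c′ x y → c ℤ.* c′ ℤ.* x ℤ.+ c ℤ.* y ≡ c ℤ.* (c′ ℤ.* x ℤ.+ y)
  lemma₂ = ℤ-solver.solve-∀

∷-*L : ∀ e c f g → ((e , c) ∷ f) *L g ≈L ((e , c) ∷ []) *L g +L f *L g
∷-*L e c f g = *L-distribʳ g ((e , c) ∷ []) f

*L-assoc : ∀ f g h → (f *L g) *L h ≈L f *L (g *L h)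
*L-assoc []            g h n = refl
*L-assoc ((e , c) ∷ f) g h n = begin
  coeff ((((e , c) ∷ f) *L g) *L h) n
    ≡⟨ *L-cong {((e , c) ∷ f) *L g} {((e , c) ∷ []) *L g +L f *L g} {h} {h} (∷-*L e c f g) (λ _ → refl) n ⟩
  coeff ((((e , c) ∷ []) *L g +L f *L g) *L h) n
    ≡⟨ *L-distribʳ h (((e , c) ∷ []) *L g) (f *L g) n ⟩
  coeff ((((e , c) ∷ []) *L g) *L h +L (f *L g) *L h) n
    ≡⟨ coeff-++ ((((e , c) ∷ []) *L g) *L h) _ n ⟩
  coeff ((((e , c) ∷ []) *L g) *L h) n ℤ.+ coeff ((f *L g) *L h) n
    ≡⟨ cong₂ ℤ._+_ (monomial-*L-assoc e c g h n) (*L-assoc f g h n) ⟩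
  c ℤ.* coeff (g *L h) (n - e) ℤ.+ coeff (f *L (g *L h)) n
    ≡⟨ coeff-∷-*L e c f (g *L h) n ⟨
  coeff (((e , c) ∷ f) *L (g *L h)) n ∎
  where open ≡-Reasoning

*L-identityˡ : ∀ f → 1L *L f ≈L f
*L-identityˡ f n = trans (coeff-qpow-*L (+ 0) f n) (cong (coeff f) (ℤₚ.+-identityʳ n))

-- Equality and the ring operations are wrapped so that they do not unfold: _≈L_ compares
-- coefficient functions, from which unification cannot recover f and g.
infix 4 _≋_
record _≋_ (f g : Laurent) : Set where
  constructor ≋-intro
  field coeff-≡ : f ≈L g
open _≋_ public

infixl 6 _⊕_
infixl 7 _⊗_
opaque
  _⊕_ : Laurent → Laurent → Laurent
  _⊕_ = _+L_

  _⊗_ : Laurent → Laurent → Laurent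
  _⊗_ = _*L_

  ⊝_ : Laurent → Laurent
  ⊝ f = ℤ.-1ℤ ·L f

opaque
  unfolding _⊕_ _⊗_ ⊝_

  coeff-⊕ : ∀ f g n → coeff (f ⊕ g) n ≡ coeff f n ℤ.+ coeff g n
  coeff-⊕ = coeff-++

  coeff-⊝ : ∀ f n → coeff (⊝ f) n ≡ - coeff f n
  coeff-⊝ f n = trans (coeff-·L ℤ.-1ℤ f n) (ℤₚ.-1*i≡-i (coeff f n))

  ⊕≡+L : ∀ f g → f ⊕ g ≡ f +L g
  ⊕≡+L f g = refl

  ⊗≡*L : ∀ f g → f ⊗ g ≡ f *L g
  ⊗≡*L f g = refl

  ⊗-assoc : ∀ f g h → (f ⊗ g) ⊗ h ≋ f ⊗ (g ⊗ h)
  ⊗-assoc f g h = ≋-intro (*L-assoc f g h)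

  ⊗-distribʳ : ∀ h f g → (f ⊕ g) ⊗ h ≋ f ⊗ h ⊕ g ⊗ h
  ⊗-distribʳ h f g = ≋-intro (*L-distribʳ h f g)

  ⊗-cong : ∀ {f f′ g g′} → f ≋ f′ → g ≋ g′ → f ⊗ g ≋ f′ ⊗ g′
  ⊗-cong {f} {f′} {g} {g′} (≋-intro f≈f′) (≋-intro g≈g′) =
    ≋-intro (*L-cong {f} {f′} {g} {g′} f≈f′ g≈g′)

  ⊗-comm : ∀ f g → f ⊗ g ≋ g ⊗ f
  ⊗-comm f g = ≋-intro (*L-comm f g)

  ⊗-identityˡ : ∀ f → 1L ⊗ f ≋ f
  ⊗-identityˡ f = ≋-intro (*L-identityˡ f)

⊕-⊗-isCommutativeRing : IsCommutativeRing _≋_ _⊕_ _⊗_ ⊝_ 0L 1L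
⊕-⊗-isCommutativeRing = record
  { isRing = record
    { +-isAbelianGroup = record
      { isGroup = record
        { isMonoid = record
          { isSemigroup = record
            { isMagma = record
              { isEquivalence = record { refl = ≋-refl ; sym = ≋-sym ; trans = ≋-trans }
              ; ∙-cong = ⊕-cong
              }
            ; assoc = ⊕-assoc
            }
          ; identity = comm∧idˡ⇒id ⊕-comm ⊕-identityˡ
          }
        ; inverse = comm∧invˡ⇒inv ⊕-comm ⊝-inverseˡ
        ; ⁻¹-cong = ⊝-cong
        }
      ; comm = ⊕-comm
      }
    ; *-cong = ⊗-cong
    ; *-assoc = ⊗-assoc
    ; *-identity = comm∧idˡ⇒id ⊗-comm ⊗-identityˡ
    ; distrib = comm∧distrʳ⇒distr ⊕-cong ⊗-comm ⊗-distribʳ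
    }
  ; *-comm = ⊗-comm
  }
  where
  ≋-refl : ∀ {f} → f ≋ f
  ≋-refl = ≋-intro λ n → refl
  ≋-sym : ∀ {f g} → f ≋ g → g ≋ f
  ≋-sym (≋-intro f≈g) = ≋-intro λ n → sym (f≈g n)
  ≋-trans : ∀ {f g h} → f ≋ g → g ≋ h → f ≋ h
  ≋-trans (≋-intro f≈g) (≋-intro g≈h) = ≋-intro λ n → trans (f≈g n) (g≈h n)
  ⊕-cong : ∀ {f f′ g g′} → f ≋ f′ → g ≋ g′ → f ⊕ g ≋ f′ ⊕ g′
  ⊕-cong {f} {f′} {g} {g′} (≋-intro f≈f′) (≋-intro g≈g′) = ≋-intro λ n →
    trans (coeff-⊕ f g n) (trans (cong₂ ℤ._+_ (f≈f′ n) (g≈g′ n)) (sym (coeff-⊕ f′ g′ n)))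
  ⊕-assoc : ∀ f g h → (f ⊕ g) ⊕ h ≋ f ⊕ (g ⊕ h)
  ⊕-assoc f g h = ≋-intro λ n → trans (coeff-⊕ (f ⊕ g) h n)
    (trans (cong (ℤ._+ coeff h n) (coeff-⊕ f g n))
    (trans (ℤₚ.+-assoc (coeff f n) (coeff g n) (coeff h n))
    (trans (cong (ℤ._+_ (coeff f n)) (sym (coeff-⊕ g h n))) (sym (coeff-⊕ f (g ⊕ h) n)))))
  ⊕-comm : ∀ f g → f ⊕ g ≋ g ⊕ f
  ⊕-comm f g = ≋-intro λ n → trans (coeff-⊕ f g n)
    (trans (ℤₚ.+-comm (coeff f n) (coeff g n)) (sym (coeff-⊕ g f n)))
  ⊕-identityˡ : ∀ f → 0L ⊕ f ≋ f
  ⊕-identityˡ f = ≋-intro λ n → trans (coeff-⊕ 0L f n) (ℤₚ.+-identityˡ (coeff f n))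
  ⊝-inverseˡ : ∀ f → ⊝ f ⊕ f ≋ 0L
  ⊝-inverseˡ f = ≋-intro λ n → trans (coeff-⊕ (⊝ f) f n)
    (trans (cong (ℤ._+ coeff f n) (coeff-⊝ f n)) (ℤₚ.+-inverseˡ (coeff f n)))
  ⊝-cong : ∀ {f g} → f ≋ g → ⊝ f ≋ ⊝ g
  ⊝-cong {f} {g} (≋-intro f≈g) = ≋-intro λ n →
    trans (coeff-⊝ f n) (trans (cong -_ (f≈g n)) (sym (coeff-⊝ g n)))
  ≋-setoid : Setoid 0ℓ 0ℓ
  ≋-setoid = record { isEquivalence = record { refl = ≋-refl ; sym = ≋-sym ; trans = ≋-trans } }
  open import Algebra.Consequences.Setoid ≋-setoid

Laurent-ring : CommutativeRing 0ℓ 0ℓ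
Laurent-ring = record { isCommutativeRing = ⊕-⊗-isCommutativeRing }

·L-*L : ∀ z f g n → coeff ((z ·L f) *L g) n ≡ z ℤ.* coeff (f *L g) n
·L-*L z []            g n = sym (ℤₚ.*-zeroʳ z)
·L-*L z ((e , c) ∷ f) g n = begin
  coeff ((z ·L ((e , c) ∷ f)) *L g) n
    ≡⟨ coeff-∷-*L e (z ℤ.* c) (z ·L f) g n ⟩
  z ℤ.* c ℤ.* coeff g (n - e) ℤ.+ coeff ((z ·L f) *L g) n
    ≡⟨ cong (ℤ._+_ (z ℤ.* c ℤ.* coeff g (n - e))) (·L-*L z f g n) ⟩
  z ℤ.* c ℤ.* coeff g (n - e) ℤ.+ z ℤ.* coeff (f *L g) n
    ≡⟨ lemma z c _ _ ⟩
  z ℤ.* (c ℤ.* coeff g (n - e) ℤ.+ coeff (f *L g) n)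
    ≡⟨ cong (z ℤ.*_) (coeff-∷-*L e c f g n) ⟨
  z ℤ.* coeff (((e , c) ∷ f) *L g) n ∎
  where
  open ≡-Reasoning
  lemma : ∀ z c x y → z ℤ.* c ℤ.* x ℤ.+ z ℤ.* y ≡ z ℤ.* (c ℤ.* x ℤ.+ y)
  lemma = ℤ-solver.solve-∀

-- Divisibility of all coefficients by an integer

remove : ℤ → Laurent → Laurent
remove e = filter (λ t → ¬? (proj₁ t ≟ e))

coeff-remove-≡ : ∀ e f → coeff (remove e f) e ≡ + 0
coeff-remove-≡ e []             = refl
coeff-remove-≡ e ((e′ , c) ∷ f) with e′ ≟ e
... | yes _   = coeff-remove-≡ e f
... | no e′≢e with e′ ≟ e
...   | yes e′≡e = contradiction e′≡e e′≢e
...   | no  _    = coeff-remove-≡ e f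

coeff-remove-≢ : ∀ {e n} f → e ≢ n → coeff (remove e f) n ≡ coeff f n
coeff-remove-≢ []             e≢n = refl
coeff-remove-≢ {e} {n} ((e′ , c) ∷ f) e≢n with e′ ≟ e
coeff-remove-≢ {e} {n} ((e′ , c) ∷ f) e≢n | yes e′≡e with e′ ≟ n
... | yes e′≡n = contradiction (trans (sym e′≡e) e′≡n) e≢n
... | no  _    = coeff-remove-≢ f e≢n
coeff-remove-≢ {e} {n} ((e′ , c) ∷ f) e≢n | no _ with e′ ≟ n
... | yes _ = cong (ℤ._+_ c) (coeff-remove-≢ f e≢n)
... | no  _ = coeff-remove-≢ f e≢n

-- Induction on a bound for the length, since all terms of the leading exponent are
-- treated at once.
coeff-quotient : ∀ z k f → length f ℕ.≤ k → (∀ n → z ℤ∣.∣ coeff f n) →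
                 ∃ λ g → ∀ n → coeff f n ≡ z ℤ.* coeff g n
coeff-quotient z k       []            _       z∣f = [] , λ n → sym (ℤₚ.*-zeroʳ z)
coeff-quotient z (suc k) ((e , c) ∷ f) (s≤s l) z∣f = (e , y) ∷ g , equal
  where
  z∣remove : ∀ n → z ℤ∣.∣ coeff (remove e f) n
  z∣remove n with e ≟ n | z∣f n
  ... | yes refl | _   = subst (z ℤ∣.∣_) (sym (coeff-remove-≡ e f)) (divides (+ 0) refl)
  ... | no e≢n   | z∣c = subst (z ℤ∣.∣_) (sym (coeff-remove-≢ f e≢n)) z∣c
  ih : ∃ λ g → ∀ n → coeff (remove e f) n ≡ z ℤ.* coeff g n
  ih = coeff-quotient z k (remove e f) (ℕₚ.≤-trans (length-filter _ f) l) z∣remove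
  g : Laurent
  g = proj₁ ih
  y : ℤ
  y = ℤ∣.quotient (z∣f e)
  equal : ∀ n → coeff ((e , c) ∷ f) n ≡ z ℤ.* coeff ((e , y) ∷ g) n
  equal n with e ≟ n
  ... | no e≢n   = trans (sym (coeff-remove-≢ f e≢n)) (proj₂ ih n)
  ... | yes refl = begin
    c ℤ.+ coeff f e              ≡⟨ head≡ ⟨
    coeff ((e , c) ∷ f) e        ≡⟨ ℤ∣._∣_.equality (z∣f e) ⟩
    y ℤ.* z                      ≡⟨ ℤₚ.*-comm y z ⟩
    z ℤ.* y                      ≡⟨ ℤₚ.+-identityʳ _ ⟨
    z ℤ.* y ℤ.+ + 0              ≡⟨ cong (ℤ._+_ (z ℤ.* y)) (trans (sym (coeff-remove-≡ e f)) (proj₂ ih e)) ⟩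
    z ℤ.* y ℤ.+ z ℤ.* coeff g e  ≡⟨ ℤₚ.*-distribˡ-+ z y _ ⟨
    z ℤ.* (y ℤ.+ coeff g e)      ∎
    where
    open ≡-Reasoning
    head≡ : coeff ((e , c) ∷ f) e ≡ c ℤ.+ coeff f e
    head≡ with e ≟ e
    ... | yes _  = refl
    ... | no e≢e = contradiction refl e≢e

-- Gives a starting point for determining coefficients upwards; for the empty sum any bound would
-- do.
bounded-below : ∀ f → ∃ λ b → ∀ n → n ℤ.< b → coeff f n ≡ + 0
bounded-below []            = + 0 , λ _ _ → refl
bounded-below ((e , c) ∷ f) with bounded-below f
... | b , zero-below = e ℤ.⊓ b , below
  where
  below : ∀ n → n ℤ.< e ℤ.⊓ b → coeff ((e , c) ∷ f) n ≡ + 0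
  below n n<e⊓b with e ≟ n
  ... | yes refl = contradiction (ℤₚ.<-≤-trans n<e⊓b (ℤₚ.i⊓j≤i e b)) (ℤₚ.<-irrefl refl)
  ... | no  _    = zero-below n (ℤₚ.<-≤-trans n<e⊓b (ℤₚ.i⊓j≤j e b))

∣coeff-*L : ∀ z f g → (∀ n → z ℤ∣.∣ coeff g n) → ∀ n → z ℤ∣.∣ coeff (f *L g) n
∣coeff-*L z []            g z∣g n = divides (+ 0) refl
∣coeff-*L z ((e , c) ∷ f) g z∣g n = subst (z ℤ∣.∣_) (sym (coeff-∷-*L e c f g n))
  (ℤ∣.∣m∣n⇒∣m+n (ℤ∣.∣n⇒∣m*n c (z∣g (n - e))) (∣coeff-*L z f g z∣g n))

-- Cancellation and torsion for q-integers in Laurent polynomials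

module QLaurent where

  opaque
    unfolding _⊗_ _⊕_

    coeff-qpow-⊗ : ∀ e f n → coeff (qpow e ⊗ f) n ≡ coeff f (n - e)
    coeff-qpow-⊗ = coeff-qpow-*L

    qpow-+ : ∀ e f → qpow (e ℤ.+ f) ≋ qpow e ⊗ qpow f
    qpow-+ e f = ≋-intro λ n → refl

    ·L-⊗ : ∀ z f g → (z ·L f) ⊗ g ≋ z ·L (f ⊗ g)
    ·L-⊗ z f g = ≋-intro λ n → trans (·L-*L z f g n) (sym (coeff-·L z (f *L g) n))

    ∣coeff-⊗ : ∀ z f g → (∀ n → z ℤ∣.∣ coeff g n) → ∀ n → z ℤ∣.∣ coeff (f ⊗ g) n
    ∣coeff-⊗ = ∣coeff-*L

  q : Laurent
  q = qpow (+ 1)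

  open CommutativeRing Laurent-ring
    using (semiring; setoid; +-congˡ; +-congʳ; +-cong; *-congˡ; *-congʳ; *-cong; *-comm; *-assoc; *-identityˡ;
           *-identityʳ; zeroʳ; distribʳ; +-identityʳ; +-identityˡ; reflexive)
    renaming (refl to ≋-refl; sym to ≋-sym; trans to ≋-trans; _-_ to _⊖_)
  open import Algebra.Properties.Semiring.Exp semiring using (_^_)
  open import Algebra.Properties.Semiring.Divisibility semiring
    using (_∣_; _,_; ∣ʳ-respʳ-≈)
  open Congruence Laurent-ring
  open Sums Laurent-ring
  open QAnalogue Laurent-ring q
  open Divisibility Laurent-ring q

  q^-qpow : ∀ n → q ^ n ≋ qpow (+ n)
  q^-qpow zero    = ≋-refl
  q^-qpow (suc n) = ≋-trans (*-congˡ (q^-qpow n)) (≋-sym (qpow-+ (+ 1) (+ n)))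

  -- `[_]` recurses by Horner's rule, whereas `qint` lists ascending powers; splitting off the top
  -- power reconciles them through `[n + 1] = [n] + q^n [1]`.
  qint-[] : ∀ n → qint n ≋ [ n ]
  qint-[] zero    = ≋-refl
  qint-[] (suc n) = begin
    map term (upTo (suc n))      ≡⟨ cong (map term) (upTo-∷ʳ n) ⟨
    map term (upTo n ++ n ∷ [])  ≡⟨ map-++ term (upTo n) (n ∷ []) ⟩
    qint n +L qpow (+ n)         ≡⟨ ⊕≡+L (qint n) (qpow (+ n)) ⟨
    qint n ⊕ qpow (+ n)          ≈⟨ +-cong (qint-[] n) (≋-sym (q^-qpow n)) ⟩
    [ n ] ⊕ q ^ n                ≈⟨ +-congˡ (*-identityʳ (q ^ n)) ⟨
    [ n ] ⊕ q ^ n ⊗ 1L           ≈⟨ +-congˡ (*-congˡ [1]≋1) ⟨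
    [ n ] ⊕ q ^ n ⊗ [ 1 ]        ≈⟨ []-+ n 1 ⟨
    [ n ℕ.+ 1 ]                  ≡⟨ cong [_] (ℕₚ.+-comm n 1) ⟩
    [ suc n ]                    ∎
    where
    open import Relation.Binary.Reasoning.Setoid setoid
    term : ℕ → ℤ × ℤ
    term k = + k , + 1
    [1]≋1 : [ 1 ] ≋ 1L
    [1]≋1 = ≋-trans (+-congˡ (zeroʳ q)) (+-identityʳ 1L)

  qbinom-binom : ∀ n k → qbinom n k ≋ binom n k
  qbinom-binom n       zero    = ≋-refl
  qbinom-binom zero    (suc k) = ≋-refl
  qbinom-binom (suc n) (suc k) = begin
    qbinom n k +L qpow (+ suc k) *L qbinom n (suc k)  ≡⟨ ⊕≡+L _ _ ⟨
    qbinom n k ⊕ qpow (+ suc k) *L qbinom n (suc k)   ≡⟨ cong (qbinom n k ⊕_) (⊗≡*L (qpow (+ suc k)) (qbinom n (suc k))) ⟨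
    qbinom n k ⊕ qpow (+ suc k) ⊗ qbinom n (suc k)    ≈⟨ +-cong (qbinom-binom n k)
                                                           (*-cong (≋-sym (q^-qpow (suc k))) (qbinom-binom n (suc k))) ⟩
    binom (suc n) (suc k)                             ∎
    where open import Relation.Binary.Reasoning.Setoid setoid

  -- Since qⁿ = 1 + (q − 1)[n], the coefficients of a multiple [n] f determine those of f
  -- recursively from below; z = 0 gives cancellation and z = 3 the absence of 3-torsion.
  ∣coeff-[]-cancel : ∀ z n f → 0 ℕ.< n → (∀ i → z ℤ∣.∣ coeff ([ n ] ⊗ f) i) → ∀ i → z ℤ∣.∣ coeff f i
  ∣coeff-[]-cancel z n f 0<n z∣[n]f i with bounded-below f
  ... | b , zero-below = below (suc ℤ.∣ i - b ∣) i i<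
    where
    q^n⊗f : q ^ n ⊗ f ≋ f ⊕ (q ⊖ 1L) ⊗ ([ n ] ⊗ f)
    q^n⊗f = ≋-trans (*-congʳ (^-[] n)) (≋-trans (distribʳ f 1L _)
      (+-cong (*-identityˡ f) (*-assoc (q ⊖ 1L) [ n ] f)))
    shifted : ∀ i → coeff f (i - + n) ≡ coeff f i ℤ.+ coeff ((q ⊖ 1L) ⊗ ([ n ] ⊗ f)) i
    shifted i = begin
      coeff f (i - + n)                               ≡⟨ coeff-qpow-⊗ (+ n) f i ⟨
      coeff (qpow (+ n) ⊗ f) i                        ≡⟨ coeff-≡ (*-congʳ (q^-qpow n)) i ⟨
      coeff (q ^ n ⊗ f) i                             ≡⟨ coeff-≡ q^n⊗f i ⟩
      coeff (f ⊕ (q ⊖ 1L) ⊗ ([ n ] ⊗ f)) i            ≡⟨ coeff-⊕ f _ i ⟩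
      coeff f i ℤ.+ coeff ((q ⊖ 1L) ⊗ ([ n ] ⊗ f)) i  ∎
      where open ≡-Reasoning
    step : ∀ i → z ℤ∣.∣ coeff f (i - + n) → z ℤ∣.∣ coeff f i
    step i z∣ = ℤ∣.∣m+n∣n⇒∣m (subst (z ℤ∣.∣_) (shifted i) z∣)
      (∣coeff-⊗ z (q ⊖ 1L) ([ n ] ⊗ f) z∣[n]f i)
    -- Each step lowers `i` by `n`, which is at least 1, so `t` steps suffice to get below `b`.
    below : ∀ t i → i ℤ.< b ℤ.+ + t → z ℤ∣.∣ coeff f i
    below zero    i i<b = subst (z ℤ∣.∣_)
      (sym (zero-below i (subst (i ℤ.<_) (ℤₚ.+-identityʳ b) i<b))) (divides (+ 0) refl)
    below (suc t) i i<b+t = step i (below t (i - + n) (ℤₚ.≤-<-trans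
      (ℤₚ.+-monoʳ-≤ i (ℤₚ.neg-mono-≤ (ℤ.+≤+ 0<n)))
      (subst (i - + 1 ℤ.<_) (lemma b (+ t)) (ℤₚ.+-monoˡ-< (- (+ 1)) i<b+t))))
      where
      lemma : ∀ b t → b ℤ.+ (+ 1 ℤ.+ t) - + 1 ≡ b ℤ.+ t
      lemma = ℤ-solver.solve-∀
    i≤∣i∣ : ∀ i → i ℤ.≤ + ℤ.∣ i ∣
    i≤∣i∣ (+ n)     = ℤₚ.≤-refl
    i≤∣i∣ -[1+ n ]  = ℤ.-≤+
    i< : i ℤ.< b ℤ.+ + suc ℤ.∣ i - b ∣
    i< = subst (ℤ._< b ℤ.+ + suc ℤ.∣ i - b ∣) (lemma i b)
      (ℤₚ.+-monoʳ-< b (ℤₚ.≤-<-trans (i≤∣i∣ (i - b)) (ℤ.+<+ (ℕₚ.n<1+n _))))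
      where
      lemma : ∀ i b → b ℤ.+ (i - b) ≡ i
      lemma = ℤ-solver.solve-∀

  []-cancel : ∀ n → 0 ℕ.< n → ∀ f → [ n ] ⊗ f ≋ 0L → f ≋ 0L
  []-cancel n 0<n f [n]f≋0 = ≋-intro λ i → ℤ∣.0∣⇒≡0 (∣coeff-[]-cancel (+ 0) n f 0<n
    (λ i → subst (+ 0 ℤ∣.∣_) (sym (coeff-≡ [n]f≋0 i)) ℤ∣.∣-refl) i)

  coeff-3⊗ : ∀ f i → coeff ((1L ⊕ (1L ⊕ 1L)) ⊗ f) i ≡ + 3 ℤ.* coeff f i
  coeff-3⊗ f i = begin
    coeff ((1L ⊕ (1L ⊕ 1L)) ⊗ f) i
      ≡⟨ coeff-≡ expand i ⟩
    coeff (f ⊕ (f ⊕ f)) i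
      ≡⟨ trans (coeff-⊕ f (f ⊕ f) i) (cong (ℤ._+_ (coeff f i)) (coeff-⊕ f f i)) ⟩
    coeff f i ℤ.+ (coeff f i ℤ.+ coeff f i)
      ≡⟨ lemma (coeff f i) ⟩
    + 3 ℤ.* coeff f i ∎
    where
    open ≡-Reasoning
    expand : (1L ⊕ (1L ⊕ 1L)) ⊗ f ≋ f ⊕ (f ⊕ f)
    expand = ≋-trans (distribʳ f 1L (1L ⊕ 1L)) (+-cong (*-identityˡ f)
      (≋-trans (distribʳ f 1L 1L) (+-cong (*-identityˡ f) (*-identityˡ f))))
    lemma : ∀ x → x ℤ.+ (x ℤ.+ x) ≡ + 3 ℤ.* x
    lemma = ℤ-solver.solve-∀

  -- The factor 3 is found in the quotient: if `h [n] = 3f`, then 3 divides the coefficients of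
  -- `[n] h`, hence those of `h`. With `h = 3g`, cancelling 3 in the integers leaves `g [n] = f`.
  []-torsion : ∀ n → 0 ℕ.< n → ∀ f → [ n ] ∣ (1L ⊕ (1L ⊕ 1L)) ⊗ f → [ n ] ∣ f
  []-torsion n 0<n f (h , h[n]≋3f) = g , ≋-intro λ i →
    ℤₚ.*-cancelˡ-≡ (+ 3) (coeff (g ⊗ [ n ]) i) (coeff f i) (begin
      + 3 ℤ.* coeff (g ⊗ [ n ]) i     ≡⟨ coeff-·L (+ 3) (g ⊗ [ n ]) i ⟨
      coeff (+ 3 ·L (g ⊗ [ n ])) i    ≡⟨ coeff-≡ (·L-⊗ (+ 3) g [ n ]) i ⟨
      coeff ((+ 3 ·L g) ⊗ [ n ]) i    ≡⟨ coeff-≡ (*-congʳ 3g≋h) i ⟩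
      coeff (h ⊗ [ n ]) i             ≡⟨ coeff-≡ h[n]≋3f i ⟩
      coeff ((1L ⊕ (1L ⊕ 1L)) ⊗ f) i  ≡⟨ coeff-3⊗ f i ⟩
      + 3 ℤ.* coeff f i               ∎)
    where
    open ≡-Reasoning
    3∣h : ∀ i → + 3 ℤ∣.∣ coeff h i
    3∣h = ∣coeff-[]-cancel (+ 3) n h 0<n λ i → divides (coeff f i)
      (trans (coeff-≡ (≋-trans (*-comm [ n ] h) h[n]≋3f) i)
        (trans (coeff-3⊗ f i) (ℤₚ.*-comm (+ 3) (coeff f i))))
    quotient : ∃ λ g → ∀ i → coeff h i ≡ + 3 ℤ.* coeff g i
    quotient = coeff-quotient (+ 3) (length h) h ℕₚ.≤-refl 3∣h
    g : Laurent
    g = proj₁ quotient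
    3g≋h : + 3 ·L g ≋ h
    3g≋h = ≋-intro λ i → trans (coeff-·L (+ 3) g i) (sym (proj₂ quotient i))

  qpow-period : ∀ {d n} f → d ℕ∣.∣ n → [ d ] ∣ qpow (+ n ℤ.+ f) ⊖ qpow f
  qpow-period {d} {n} f d∣n = ∼-trans
    (∼-reflexive (≋-trans (qpow-+ (+ n) f) (*-congʳ (≋-sym (q^-qpow n)))))
    (∼-trans (∼-*ʳ (qpow f) (^-∼1 n ([]-mono-∣ d∣n))) (∼-reflexive (*-identityˡ (qpow f))))
    where open Modulo [ d ]

  -- If `e - f` is negative, `e` and `f` are exchanged, so that `q^n ≡ 1` is only used for natural
  -- `n`.
  qpow-∼ : ∀ {d e f} → + d ℤᵤ.∣ e - f → [ d ] ∣ qpow e ⊖ qpow f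
  qpow-∼ {d} {e} {f} d∣e-f with e - f in eq
  ... | + n = subst (λ e → [ d ] ∣ qpow e ⊖ qpow f)
      (trans (cong (ℤ._+ f) (sym eq)) (lemma e f)) (qpow-period f d∣e-f)
    where
    lemma : ∀ e f → e - f ℤ.+ f ≡ e
    lemma = ℤ-solver.solve-∀
  ... | -[1+ n ] = ∼-sym (subst (λ f → [ d ] ∣ qpow f ⊖ qpow e)
      (trans (cong (λ x → - x ℤ.+ e) (sym eq)) (lemma e f)) (qpow-period e d∣e-f))
    where
    open Modulo [ d ]
    lemma : ∀ e f → - (e - f) ℤ.+ e ≡ f
    lemma = ℤ-solver.solve-∀

  -- The Legendre symbol modulo 3

  χ : ℕ → ℤ
  χ 0 = + 0
  χ 1 = + 1
  χ _ = - (+ 1)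

  -- Separates the symbol from the residue, so that equations between residues transfer by
  -- congruence.
  legendre3-χ : ∀ k → legendre3 k ≡ χ (k ℕ.% 3)
  legendre3-χ k with k ℕ.% 3
  ... | 0           = refl
  ... | 1           = refl
  ... | suc (suc _) = refl

  legendre3-zero : ∀ k → 3 ℕ∣.∣ k → legendre3 k ≡ + 0
  legendre3-zero k 3∣k = trans (legendre3-χ k) (cong χ (ℕ∣.n∣m⇒m%n≡0 k 3 3∣k))

  legendre3-period : ∀ r {k} → 3 ℕ∣.∣ k → legendre3 (r ℕ.+ k) ≡ legendre3 r
  legendre3-period r (ℕ∣.divides t refl) = trans (legendre3-χ (r ℕ.+ t ℕ.* 3))
    (trans (cong χ (ℕ%.[m+kn]%n≡m%n r t 3)) (sym (legendre3-χ r)))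

  legendre3-anti : ∀ r s → 3 ℕ∣.∣ r ℕ.+ s → legendre3 r ℤ.+ legendre3 s ≡ + 0
  legendre3-anti r s 3∣r+s = trans (cong₂ ℤ._+_ (legendre3-χ r) (legendre3-χ s))
    (cases (r ℕ.% 3) (s ℕ.% 3) (ℕ%.m%n<n r 3) (ℕ%.m%n<n s 3)
      (trans (sym (ℕ%.%-distribˡ-+ r s 3)) (ℕ∣.n∣m⇒m%n≡0 (r ℕ.+ s) 3 3∣r+s)))
    where
    cases : ∀ x y → x ℕ.< 3 → y ℕ.< 3 → (x ℕ.+ y) ℕ.% 3 ≡ 0 → χ x ℤ.+ χ y ≡ + 0
    cases 0 0 _ _ _ = refl
    cases 1 2 _ _ _ = refl
    cases 2 1 _ _ _ = refl
    cases 0 1 _ _ ()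
    cases 0 2 _ _ ()
    cases 1 0 _ _ ()
    cases 1 1 _ _ ()
    cases 2 0 _ _ ()
    cases 2 2 _ _ ()
    cases (suc (suc (suc x))) y (s≤s (s≤s (s≤s ())))
    cases x (suc (suc (suc y))) _ (s≤s (s≤s (s≤s ())))

  ·L-cong : ∀ z {f g} → f ≋ g → z ·L f ≋ z ·L g
  ·L-cong z {f} {g} f≋g = ≋-intro λ n →
    trans (coeff-·L z f n) (trans (cong (z ℤ.*_) (coeff-≡ f≋g n)) (sym (coeff-·L z g n)))

  ·L-zeroˡ : ∀ f → + 0 ·L f ≋ 0L
  ·L-zeroˡ f = ≋-intro λ n → coeff-·L (+ 0) f n

  ·L-distribʳ : ∀ y z f → y ·L f ⊕ z ·L f ≋ (y ℤ.+ z) ·L f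
  ·L-distribʳ y z f = ≋-intro λ n → trans (coeff-⊕ (y ·L f) (z ·L f) n)
    (trans (cong₂ ℤ._+_ (coeff-·L y f n) (coeff-·L z f n))
      (trans (sym (ℤₚ.*-distribʳ-+ (coeff f n) y z)) (sym (coeff-·L (y ℤ.+ z) f n))))

  ·L-1L-⊗ : ∀ z f → (z ·L 1L) ⊗ f ≋ z ·L f
  ·L-1L-⊗ z f = ≋-trans (·L-⊗ z 1L f) (·L-cong z (*-identityˡ f))

  ·L-∼ : ∀ {p f g} z → p ∣ f ⊖ g → p ∣ z ·L f ⊖ z ·L g
  ·L-∼ {p} {f} {g} z f∼g = ∼-trans (∼-reflexive (≋-sym (·L-1L-⊗ z f)))
    (∼-trans (∼-*ˡ (z ·L 1L) f∼g) (∼-reflexive (·L-1L-⊗ z g)))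
    where open Modulo p

  foldr-∑ : ∀ n (f : ℕ → Laurent) → foldr _+L_ 0L (map f (upTo n)) ≡ ∑ n f
  foldr-∑ n f = trans (cong (foldr _+L_ 0L) (map-upTo f n)) (go n f)
    where
    go : ∀ n (f : ℕ → Laurent) → foldr _+L_ 0L (applyUpTo f n) ≡ ∑ n f
    go zero    f = refl
    go (suc n) f = trans (cong (f 0 +L_) (go n (λ i → f (suc i)))) (sym (⊕≡+L (f 0) _))

  -- `sumFrom1 n` covers the indices `1, ..., n - 1`; the vanishing term at 0 completes them to the
  -- range that is cut into blocks.
  sumFrom1-∑ : ∀ n f → 0 ℕ.< n → f 0 ≋ 0L → sumFrom1 n f ≋ ∑ n f
  sumFrom1-∑ (suc n) f _ f0≋0 = ≋-trans (reflexive (foldr-∑ n (λ k → f (suc k))))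
    (≋-trans (≋-sym (+-identityˡ _)) (+-congʳ (≋-sym f0≋0)))

  -- The coefficients `(k/3) q^ψ(k)` and the conclusion

  module Main (a m : ℕ) (1≤m : 1 ℕ.≤ m) (ψ : ℤ → ℤ)
    (ψ-cond : ∀ (k : ℤ) (j : ℕ) → 1 ℕ.≤ j → j ℕ.≤ a →
              (+ (3 ℕ.^ a) ℤᵤ.∣ ψ k - ψ (- k)) × (+ (3 ℕ.^ j) ℤᵤ.∣ ψ (k ℤ.+ + (3 ℕ.^ j)) - ψ k))
    where

    P n : ℕ
    P = 3 ℕ.^ a
    n = ℕ.pred (2 ℕ.* P ℕ.* m)
    0<P : 0 ℕ.< P
    0<P = ℕₚ.m^n>0 3 a
    suc-n : suc n ≡ 2 ℕ.* P ℕ.* m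
    suc-n = ℕₚ.suc-pred _ {{ℕ.>-nonZero
      (ℕₚ.*-mono-< {0} {2 ℕ.* P} (ℕₚ.*-mono-< {0} {2} (s≤s z≤n) 0<P) 1≤m)}}

    summand : ℕ → Laurent
    summand k = legendre3 k ·L (qpow (ψ (+ k)) *L qbinom (2 ℕ.* P ℕ.* m) k)

    ε : ℕ → Laurent
    ε k = legendre3 k ·L qpow (ψ (+ k))

    ε-zero : ∀ k → 3 ℕ∣.∣ k → ε k ≋ 0L
    ε-zero k 3∣k = ≋-trans (reflexive (cong (_·L qpow (ψ (+ k))) (legendre3-zero k 3∣k)))
      (·L-zeroˡ (qpow (ψ (+ k))))

    ψ-period : ∀ j → j ℕ.< a → ∀ k → [ 3 ℕ.^ suc j ] ∣ qpow (ψ (k ℤ.+ + (3 ℕ.^ suc j))) ⊖ qpow (ψ k)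
    ψ-period j j<a k = qpow-∼ {e = ψ (k ℤ.+ + (3 ℕ.^ suc j))} (proj₂ (ψ-cond k (suc j) (s≤s z≤n) j<a))

    ψ-even : ∀ j → j ℕ.< a → ∀ k → [ 3 ℕ.^ suc j ] ∣ qpow (ψ k) ⊖ qpow (ψ (- k))
    ψ-even j j<a k = qpow-∼ {e = ψ k} (ℕ∣.∣-trans 3^j∣P (proj₁ (ψ-cond k (suc j) (s≤s z≤n) j<a)))
      where
      3^j∣P : 3 ℕ.^ suc j ℕ∣.∣ P
      3^j∣P = ℕ∣.divides (3 ℕ.^ (a ℕ.∸ suc j)) (trans (cong (3 ℕ.^_) (sym (ℕₚ.m∸n+n≡m j<a)))
        (ℕₚ.^-distribˡ-+-* 3 (a ℕ.∸ suc j) (suc j)))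

    -- Here `s = -r + d`, so periodicity at the negative argument `-r` gives `ψ(s) ≡ ψ(-r)`, and
    -- evenness gives `ψ(-r) ≡ ψ(r)`. The powers of `q` therefore agree modulo `[d]`, while the
    -- Legendre symbols are opposite because 3 divides `r + s`.
    ε-anti : ∀ j → j ℕ.< a → ∀ r s → r ℕ.+ s ≡ 3 ℕ.^ suc j → [ 3 ℕ.^ suc j ] ∣ ε r ⊕ ε s
    ε-anti j j<a r s r+s≡d = ∼0⇒∣ (∼-trans (∼-+ ∼-refl (·L-∼ (legendre3 s) Q∼))
        (∼-reflexive (≋-trans (·L-distribʳ (legendre3 r) (legendre3 s) _)
          (≋-trans (reflexive (cong (_·L qpow (ψ (+ r))) (legendre3-anti r s
            (subst (3 ℕ∣.∣_) (sym r+s≡d) (ℕ∣.m∣m*n (3 ℕ.^ j)))))) (·L-zeroˡ (qpow (ψ (+ r))))))))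
      where
      open Modulo [ 3 ℕ.^ suc j ]
      s≡ : - (+ r) ℤ.+ + (3 ℕ.^ suc j) ≡ + s
      s≡ = trans (cong (λ d → - (+ r) ℤ.+ + d) (sym r+s≡d)) (lemma (+ r) (+ s))
        where
        lemma : ∀ r s → - r ℤ.+ (r ℤ.+ s) ≡ s
        lemma = ℤ-solver.solve-∀
      Q∼ : qpow (ψ (+ s)) ∼ qpow (ψ (+ r))
      Q∼ = ∼-trans (subst (λ k → qpow (ψ k) ∼ qpow (ψ (- (+ r)))) s≡ (ψ-period j j<a (- (+ r))))
        (∼-sym (ψ-even j j<a (+ r)))

    ε-period : ∀ j → j ℕ.< a → ∀ r u → [ 3 ℕ.^ suc j ] ∣ ε (r ℕ.+ u ℕ.* 3 ℕ.^ suc j) ⊖ ε r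
    ε-period j j<a r u = ∼-trans (·L-∼ (legendre3 (r ℕ.+ u ℕ.* d)) (Q∼ u))
        (∼-reflexive (reflexive (cong (_·L qpow (ψ (+ r)))
          (legendre3-period r (ℕ∣.∣n⇒∣m*n u (ℕ∣.m∣m*n (3 ℕ.^ j)))))))
      where
      open Modulo [ 3 ℕ.^ suc j ]
      d : ℕ
      d = 3 ℕ.^ suc j
      Q∼ : ∀ u → qpow (ψ (+ (r ℕ.+ u ℕ.* d))) ∼ qpow (ψ (+ r))
      Q∼ zero    = ∼-reflexive (reflexive (cong (λ k → qpow (ψ (+ k))) (ℕₚ.+-identityʳ r)))
      Q∼ (suc u) = ∼-trans
        (subst (λ k → qpow (ψ k) ∼ qpow (ψ (+ (r ℕ.+ u ℕ.* d)))) (cong +_ shift)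
          (ψ-period j j<a (+ (r ℕ.+ u ℕ.* d))))
        (Q∼ u)
        where
        shift : r ℕ.+ u ℕ.* d ℕ.+ d ≡ r ℕ.+ suc u ℕ.* d
        shift = trans (ℕₚ.+-assoc r (u ℕ.* d) d) (cong (r ℕ.+_) (ℕₚ.+-comm (u ℕ.* d) d))

    summand≋ : ∀ k → ε k ⊗ binom (suc n) k ≋ summand k
    summand≋ k = ≋-trans (·L-⊗ (legendre3 k) (qpow (ψ (+ k))) _) (·L-cong (legendre3 k)
      (≋-trans (*-congˡ (≋-trans (≋-sym (qbinom-binom (suc n) k))
          (reflexive (cong (λ n → qbinom n k) suc-n))))
        (reflexive (⊗≡*L (qpow (ψ (+ k))) (qbinom (2 ℕ.* P ℕ.* m) k)))))

    ∑≋sum : ∑ (P ℕ.* m) (λ k → ε k ⊗ binom (suc n) k) ≋ sumFrom1 (P ℕ.* m) summand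
    ∑≋sum = ≋-trans (∑-cong (P ℕ.* m) summand≋) (≋-sym (sumFrom1-∑ (P ℕ.* m) summand
      (ℕₚ.*-mono-< 0<P 1≤m)
      (·L-zeroˡ (qpow (ψ (+ 0)) *L qbinom (2 ℕ.* P ℕ.* m) 0))))

    conclude : ∀ {f} → [ P ] ⊗ [ P ] ∣ f → (qint P *L qint P) ∣L f
    conclude {f} (h , eq) = h , coeff-≡ (≋-sym (≋-trans
      (reflexive (trans (cong (_*L h) (sym (⊗≡*L (qint P) (qint P)))) (sym (⊗≡*L _ h))))
      (≋-trans (*-congʳ (*-cong (qint-[] P) (qint-[] P))) (≋-trans (*-comm _ h) eq))))

    [P]²∣sum : (qint P *L qint P) ∣L sumFrom1 (P ℕ.* m) summand
    [P]²∣sum = conclude (∣ʳ-respʳ-≈ ∑≋sum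
      ([P]²∣∑ []-cancel []-torsion a m 1≤m ε ε-zero ε-anti ε-period n suc-n))

open import Data.Nat using (_^_; _*_; _≤_)
open import Data.Integer.Divisibility using (_∣_)

theorem2p1 : (a m : ℕ) → 1 ≤ a → 1 ≤ m → (ψ : ℤ → ℤ) →
    (∀ (k : ℤ) (j : ℕ) → 1 ≤ j → j ≤ a →
    ((+ (3 ^ a)) ∣ (ψ k - ψ (- k))) ×
    ((+ (3 ^ j)) ∣ (ψ (k ℤ.+ + (3 ^ j)) - ψ k))) →
    (qint (3 ^ a) *L qint (3 ^ a)) ∣L
    sumFrom1 (3 ^ a * m)
    (λ k → legendre3 k ·L (qpow (ψ (+ k)) *L qbinom (2 * 3 ^ a * m) k))
theorem2p1 a m _ 1≤m ψ ψ-cond = QLaurent.Main.[P]²∣sum a m 1≤m ψ ψ-cond
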